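{- Let $M$ be a matroid with ground set $E$ and a cycle system $\mathcal{C}=\{C_1,\dots,C_g\}$, where $g=g(M)$. 1. There is an explicit bijection between the set of bases of $M$ and the set $P^*(\mathcal{C})$ of coparking functions defined by $\mathcal{C}$. Precisely, fix any linear ordering of $E$. The following two procedures are well defined and terminate, and they define mutually inverse bijections between the set of bases of $M$ and $P^*(\mathcal{C})$. (Basis to coparking.) Input a basis $B$ of $M$. Set $\sigma=[g]$ and $a=(0,\dots,0)\in\mathbb{N}^g$. While $\sigma\ne\emptyset$: let $e$ be the maximal element of the unique union $\mathcal{C}_\sigma$ of the current sets $C_j$, $j\in\sigma$, and let $i$ be the unique index in $\sigma$ with $e\in C_i$; if $e\notin B$, replace $\sigma$ by $\sigma\setminus\{i\}$; if $e\in B$, replace $a_i$ by $a_i+1$ and replace $C_i$ by $C_i\setminus\{e\}$. Output $a$. (Coparking to basis.) Input $a\in P^*(\mathcal{C})$. Set $\sigma=[g]$ and $B=E$. While $\sigma\neq\emptyset$: let $e$ be the maximal element of the unique union $\mathcal{C}_\sigma$ of the current sets $C_j$, $j\in\sigma$, and let $i$ be the unique index in $\sigma$ with $e\in C_i$; replace $a_i$ by $a_i-1$; if now $a_i<0$, replace $\sigma$ by $\sigma\setminus\{i\}$ and $B$ by $B\setminus\{e\}$; otherwise replace $C_i$ by $C_i\setminus\{e\}$. Output $B$. 2. Stanley's conjecture holds for $M$: the $h$-vector of $M$ is a pure O-sequence.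
   Context: Matroids are on finite ground sets; $r(M)$ is the rank and $g(M)=|E(M)|-r(M)$ the corank. $\mathbb{N}$ includes $0$, and $\mathbb{N}^0=\{()\}$. A *cycle* of $M$ is a union of circuits of $M$. Unique union: for a family $\mathcal{A}=\{A_1,\dots,A_g\}$ of subsets of a set and $\sigma\subseteq[g]=\{1,\dots,g\}$, $\mathcal{A}_\sigma$ is the set of elements $e\in\bigcup_{i\in\sigma}A_i$ for which there is exactly one $i\in\sigma$ with $e\in A_i$. A *cycle system* for $M$ is a collection $\mathcal{C}=\{C_1,\dots,C_g\}$ of cycles of $M$ with $g=g(M)$ such that for every nonempty $\sigma\subseteq[g]$ the unique union $\mathcal{C}_\sigma$ is dependent in $M$. A *coparking function* with respect to $\mathcal{C}$ is a vector $a=(a_1,\dots,a_g)\in\mathbb{N}^g$ such that for every nonempty $\sigma\subseteq[g]$ there is some $i\in\sigma$ with $a_i<|C_i\cap\mathcal{C}_\sigma|$ (if $g=0$, the only one is $()$). $P^*(\mathcal{C})$ is the set of coparking functions. The $h$-vector $h(M)=(h_0,\dots,h_d)$, $d=r(M)$, is defined by $\sum_{k=0}^d h_k t^{d-k}=\sum_{i=0}^d f_{i-1}(t-1)^{d-i}$, where $f_{i-1}$ is the number of independent sets of $M$ of size $i$. A sequence $(h_0,h_1,\dots)$ is a *pure O-sequence* if for some $n$ there is a finite nonempty subset $\Delta\subseteq\mathbb{N}^n$, closed under passing to componentwise smaller vectors, all of whose (componentwise) maximal elements have the same coordinate sum, such that $h_i$ is the number of elements of $\Delta$ with coordinate sum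 $i$ for all $i$ (trailing zeros in the sequence are disregarded). -}

module Defs where

open import Data.Bool using (if_then_else_)
open import Data.Fin using (Fin)
open import Data.Fin.Subset
  using (Subset; inside; outside; _∈_; _∉_; _⊆_; _⊂_; _∩_; _∪_; _-_; ⁅_⁆; ⋃; ⊤; ⊥; ∣_∣; Nonempty; Empty)
open import Data.Fin.Subset.Properties using (_∈?_)
open import Data.Integer as ℤ using (ℤ; 0ℤ; 1ℤ; -1ℤ)
open import Data.List using (List; []; _∷_; _++_; length; map; filter; foldr; applyUpTo)
open import Data.List.Extrema.Nat using (max)
open import Data.List.Membership.Propositional using () renaming (_∈_ to _∈ˡ_)
open import Data.List.Relation.Unary.All using (All)
open import Data.List.Relation.Unary.Unique.Propositional using (Unique)
open import Data.Nat as ℕ using (ℕ; zero; suc; _∸_; _≤_; _<_)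
open import Data.Product using (Σ; ∃; ∃-syntax; ∃!; _×_; _,_; proj₁)
open import Data.Vec as Vec using (Vec; lookup; tabulate; replicate; sum; _[_]%=_)
open import Data.Vec.Relation.Binary.Pointwise.Inductive using (Pointwise)
open import Function using (flip)
open import Induction.WellFounded using (Acc)
open import Level using (0ℓ)
open import Relation.Binary using (Rel; Setoid)
open import Relation.Binary.Construct.Closure.ReflexiveTransitive using (Star)
import Relation.Binary.Construct.On as On
open import Relation.Binary.PropositionalEquality using (_≡_; _≢_; setoid)
open import Relation.Nullary using (¬_; does)
open import Relation.Unary using (Decidable)

record Matroid (n : ℕ) : Set₁ where
  field
    Indep      : Subset n → Set
    indep?     : Decidable Indep
    ⊥-indep    : Indep ⊥
    hereditary : ∀ {I J} → I ⊆ J → Indep J → Indep I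
    exchange   : ∀ {I J} → Indep I → Indep J → ∣ I ∣ < ∣ J ∣ →
                 ∃[ e ] e ∈ J × e ∉ I × Indep (I ∪ ⁅ e ⁆)

  Dependent : Subset n → Set
  Dependent A = ¬ Indep A

allSubsets : ∀ n → List (Subset n)
allSubsets zero    = Vec.[] ∷ []
allSubsets (suc n) = map (outside Vec.∷_) (allSubsets n) ++ map (inside Vec.∷_) (allSubsets n)

module _ {n} (M : Matroid n) where
  open Matroid M

  IsBasis : Subset n → Set
  IsBasis B = Indep B × (∀ {I} → Indep I → B ⊆ I → I ≡ B)

  IsCircuit : Subset n → Set
  IsCircuit C = Dependent C × (∀ {A} → A ⊂ C → Indep A)

  IsCycle : Subset n → Set
  IsCycle C = ∃[ Ds ] All IsCircuit Ds × C ≡ ⋃ Ds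

  independentSets : List (Subset n)
  independentSets = filter indep? (allSubsets n)

  rank : ℕ
  rank = max 0 (map ∣_∣ independentSets)

  corank : ℕ
  corank = n ∸ rank

  #indep : ℕ → ℕ
  #indep i = length (filter (λ I → ∣ I ∣ ℕ.≟ i) independentSets)

  -- Bases are compared as subsets, ignoring the proofs of basishood.
  Bases : Setoid 0ℓ 0ℓ
  Bases = On.setoid {B = Σ (Subset n) IsBasis} (setoid (Subset n)) proj₁

module _ {n g} (𝒜 : Vec (Subset n) g) where

  indicesOf : Fin n → Subset g
  indicesOf e = Vec.map (λ A → lookup A e) 𝒜

  uniqueUnion : Subset g → Subset n
  uniqueUnion σ = tabulate λ e → does (∣ σ ∩ indicesOf e ∣ ℕ.≟ 1)

record IsCycleSystem {n g} (M : Matroid n) (𝒞 : Vec (Subset n) g) : Set where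
  open Matroid M
  field
    size-corank : g ≡ corank M
    cycles      : ∀ i → IsCycle M (lookup 𝒞 i)
    dependent   : ∀ σ → Nonempty σ → Dependent (uniqueUnion 𝒞 σ)

IsCoparking : ∀ {n g} → Vec (Subset n) g → Vec ℕ g → Set
IsCoparking 𝒞 a = ∀ σ → Nonempty σ →
  ∃[ i ] i ∈ σ × lookup a i < ∣ lookup 𝒞 i ∩ uniqueUnion 𝒞 σ ∣

-- Coparking functions are compared as vectors.
P* : ∀ {n g} → Vec (Subset n) g → Setoid 0ℓ 0ℓ
P* {g = g} 𝒞 = On.setoid {B = Σ (Vec ℕ g) (IsCoparking 𝒞)} (setoid (Vec ℕ g)) proj₁

-- Both procedures are while loops, treated as transition systems, over the
-- current index set σ and the current sets C_j; the type X holds the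
-- remaining variables.
record State (n g : ℕ) (X : Set) : Set where
  constructor ⟨_,_,_⟩
  field
    indices : Subset g
    sets    : Vec (Subset n) g
    vars    : X

open State public

module Procedures {n g : ℕ} (_≼_ : Rel (Fin n) 0ℓ) where

  -- e is the maximal element of the current unique union, and i is an
  -- index in σ with e ∈ C_i.
  Selects : ∀ {X} → State n g X → Fin n × Fin g → Set
  Selects ⟨ σ , 𝒞 , _ ⟩ (e , i) =
    e ∈ uniqueUnion 𝒞 σ × (∀ {e′} → e′ ∈ uniqueUnion 𝒞 σ → e′ ≼ e) ×
    i ∈ σ × e ∈ lookup 𝒞 i

  module Loop {X : Set} (body : Fin n → Fin g → State n g X → State n g X) where

    -- The guard σ ≠ ∅ is implied by i ∈ σ in Selects.
    data _⟶_ (s : State n g X) : State n g X → Set where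
      step : ∀ {e i} → Selects s (e , i) → s ⟶ body e i s

    WellDefined : State n g X → Set
    WellDefined s₀ = ∀ {s} → Star _⟶_ s₀ s → Nonempty (indices s) → ∃! _≡_ (Selects s)

    Terminates : State n g X → Set
    Terminates = Acc (flip _⟶_)

    EndsWith : State n g X → X → Set
    EndsWith s₀ x = ∃[ s ] Star _⟶_ s₀ s × Empty (indices s) × vars s ≡ x

  module BasisToCoparking (𝒞₀ : Vec (Subset n) g) (B : Subset n) where

    body : Fin n → Fin g → State n g (Vec ℕ g) → State n g (Vec ℕ g)
    body e i ⟨ σ , 𝒞 , a ⟩ =
      if does (e ∈? B)
        then ⟨ σ , 𝒞 [ i ]%= (_- e) , a [ i ]%= suc ⟩
        else ⟨ σ - i , 𝒞 , a ⟩

    start : State n g (Vec ℕ g)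
    start = ⟨ ⊤ , 𝒞₀ , replicate g 0 ⟩

    WellDefined Terminates : Set
    WellDefined = Loop.WellDefined body start
    Terminates  = Loop.Terminates body start

    Outputs : Vec ℕ g → Set
    Outputs = Loop.EndsWith body start

  module CoparkingToBasis (𝒞₀ : Vec (Subset n) g) (a₀ : Vec ℕ g) where

    body : Fin n → Fin g → State n g (Vec ℤ g × Subset n) → State n g (Vec ℤ g × Subset n)
    body e i ⟨ σ , 𝒞 , (a , B) ⟩ =
      let a′ = a [ i ]%= ℤ.pred in
      if does (lookup a′ i ℤ.<? 0ℤ)
        then ⟨ σ - i , 𝒞 , (a′ , B - e) ⟩
        else ⟨ σ , 𝒞 [ i ]%= (_- e) , (a′ , B) ⟩

    start : State n g (Vec ℤ g × Subset n)
    start = ⟨ ⊤ , 𝒞₀ , (Vec.map ℤ.+_ a₀ , ⊤) ⟩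

    WellDefined Terminates : Set
    WellDefined = Loop.WellDefined body start
    Terminates  = Loop.Terminates body start

    Outputs : Subset n → Set
    Outputs B = ∃[ a ] Loop.EndsWith body start (a , B)

-- Coefficients are listed with the constant term first.
Poly : Set
Poly = List ℤ

infixl 6 _⊞_
infixl 7 _⊠_
infixr 8 _^ᵖ_

_⊞_ : Poly → Poly → Poly
[]      ⊞ q       = q
(a ∷ p) ⊞ []      = a ∷ p
(a ∷ p) ⊞ (b ∷ q) = a ℤ.+ b ∷ p ⊞ q

_⊠_ : Poly → Poly → Poly
[]      ⊠ q = []
(a ∷ p) ⊠ q = map (a ℤ.*_) q ⊞ (0ℤ ∷ p ⊠ q)

_^ᵖ_ : Poly → ℕ → Poly
p ^ᵖ zero  = 1ℤ ∷ []
p ^ᵖ suc k = p ⊠ (p ^ᵖ k)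

t-1 : Poly
t-1 = -1ℤ ∷ 1ℤ ∷ []

-- Lists are extended by zeros beyond their end.
entry : List ℤ → ℕ → ℤ
entry []       _       = 0ℤ
entry (x ∷ xs) zero    = x
entry (x ∷ xs) (suc k) = entry xs k

module _ {n} (M : Matroid n) where

  -- Σ_{i=0}^{d} f_{i-1} (t - 1)^{d-i}, where d is the rank
  hPoly : Poly
  hPoly = foldr _⊞_ [] (applyUpTo (λ i → (ℤ.+ #indep M i ∷ []) ⊠ t-1 ^ᵖ (rank M ∸ i)) (suc (rank M)))

  -- h_k is the coefficient of t^{d-k}, for k = 0, …, d.
  hVector : List ℤ
  hVector = applyUpTo (λ k → entry hPoly (rank M ∸ k)) (suc (rank M))

_≤ᵛ_ : ∀ {m} → Rel (Vec ℕ m) 0ℓ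
_≤ᵛ_ = Pointwise _≤_

module _ {m} (Δ : List (Vec ℕ m)) where
  IsMaximal : Vec ℕ m → Set
  IsMaximal a = a ∈ˡ Δ × (∀ {b} → b ∈ˡ Δ → a ≤ᵛ b → b ≡ a)

  -- A finite subset of ℕ^m is given as a duplicate-free list.
  record IsPureOrderIdeal : Set where
    field
      unique     : Unique Δ
      nonempty   : Δ ≢ []
      downClosed : ∀ {a b} → a ∈ˡ Δ → b ≤ᵛ a → b ∈ˡ Δ
      pure       : ∀ {a b} → IsMaximal a → IsMaximal b → sum a ≡ sum b

  #ofDegree : ℕ → ℕ
  #ofDegree i = length (filter (λ a → sum a ℕ.≟ i) Δ)

IsPureOSequence : List ℤ → Set
IsPureOSequence h = ∃[ m ] Σ (List (Vec ℕ m)) λ Δ →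
  IsPureOrderIdeal Δ × (∀ i → entry h i ≡ ℤ.+ #ofDegree Δ i)

{-# OPTIONS --safe #-}

-- Deleting or contracting an element e that lies in exactly one of the current
-- sets, say C_i, turns a cycle system into a cycle system of the minor:
-- deletion drops the index i, contraction removes e from C_i. On coparking
-- functions this is the split into a_i = 0 and a_i > 0. Both procedures walk
-- down the resulting tree, which gives the bijection. Following any
-- independent set instead of a basis down the same tree shows that the
-- independent sets are partitioned into the intervals [K, B], where K is the
-- set of elements contracted on the path to B, and |K| is the degree of the
-- coparking function; summing (t - 1)^(r - |I|) over each interval gives
-- t^(r - |K|), so h_k counts the coparking functions of degree k.
module Submission where

open import Algebra.Properties.CommutativeSemigroup using (interchange)
open import Data.Bool using (true; false; if_then_else_)
open import Data.Fin using (Fin; zero; suc)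
import Data.Fin.Properties as Fin
open import Data.Fin.Subset
open import Data.Fin.Subset.Properties
open import Data.Integer as ℤ using (ℤ; 0ℤ; 1ℤ)
import Data.Integer.Properties as ℤ
open import Data.List using (List; []; _∷_; _++_; map; filter; foldr; upTo; applyUpTo; length; allFin)
import Data.List.Extrema.Nat as Extrema
import Data.List.Membership.Propositional as List
open import Data.List.Membership.Propositional.Properties
  using (∈-filter⁺; ∈-filter⁻; ∈-map⁺; ∈-map⁻; ∈-++⁺ˡ; ∈-++⁺ʳ; ∈-++⁻; ∈-allFin)
open import Data.List.Properties using (map-applyUpTo; filter-none)
open import Data.List.Relation.Unary.All as All using (All; []; _∷_)
open import Data.List.Relation.Unary.All.Properties using (all-filter)
open import Data.List.Relation.Unary.AllPairs using ([]; _∷_)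
open import Data.List.Relation.Unary.Any using (here; there)
open import Data.List.Relation.Unary.Unique.Propositional using (Unique)
import Data.List.Relation.Unary.Unique.Propositional.Properties as Unique
open import Data.Nat as ℕ using (ℕ; zero; suc; pred; _+_; _∸_; _≤_; _<_; z≤n; s≤s)
open import Data.Nat.Properties
open import Data.Product using (Σ; ∃; ∃-syntax; ∃!; _×_; _,_; proj₁; proj₂)
open import Data.Sum using (_⊎_; inj₁; inj₂)
open import Data.Vec using (Vec; []; _∷_; here; there; lookup; _[_]%=_; sum; replicate; tabulate)
import Data.Vec as Vec
open import Data.Vec.Properties
  using ([]=⇒lookup; lookup⇒[]=; lookup-map; lookup-replicate; lookup∘tabulate; lookup∘updateAt;
         lookup∘updateAt′; updateAt-updateAt-local; updateAt-id-local)
open import Data.Vec.Relation.Binary.Pointwise.Inductive as Pointwise using ([]; _∷_)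
open import Defs
open import Function using (_∘_; id; const)
open import Function.Bundles using (Inverse)
open import Induction.WellFounded using (acc)
open import Level using (0ℓ)
open import Relation.Binary using (Rel; IsTotalOrder; TotalOrder)
open import Relation.Binary.Construct.Closure.ReflexiveTransitive using (Star; ε; _◅_)
open import Relation.Binary.PropositionalEquality
open import Relation.Nullary using (¬_; Dec; yes; no; does; contradiction; _×-dec_)
open import Relation.Nullary.Decidable using (dec-true; dec-false)
open import Relation.Unary using (Decidable)

-- No minor is formed as a matroid: it is recorded by two subsets K and S of the ground set, and
-- independence always refers to `M`. The invariants that |S| = |σ| + r and that S contains an
-- independent set of size r force S to be a basis once σ is empty. The obstacle is that contracting
-- a selected element can make K dependent. Such branches are kept: no independent set contains K,
-- and no coparking function survives there, because following one down would end in an independent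
-- S containing K. When K is independent, dependence of the unique union together with K supplies a
-- next element to select, so the descent stops only at empty σ. Purity does not come from the tree.
-- Every coparking function lies below one of degree |⋃ C_i| - g: raising the coordinates along an
-- order of the indices cuts ⋃ C_i into g private parts, each one larger than the coordinate it
-- bounds.

private
  variable
    n g : ℕ
    p q : Subset n
    x y : Fin n

-- Cardinalities of subsets

x∈p-y⁻ : x ∈ p - y → x ∈ p × x ≢ y
x∈p-y⁻ {p = p} {y = y} x∈ = p─q⊆p p ⁅ y ⁆ x∈ , λ { refl → x∉p-x p x∈ }
  where
  x∉p-x : ∀ {n} {x : Fin n} (p : Subset n) → x ∉ p - x
  x∉p-x {x = zero}  (_ ∷ _) ()
  x∉p-x {x = suc _} (_ ∷ p) (there x∈) = x∉p-x p x∈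

∣p∣≡suc∣p-x∣ : x ∈ p → ∣ p ∣ ≡ suc ∣ p - x ∣
∣p∣≡suc∣p-x∣ {p = _ ∷ p} here = cong (suc ∘ ∣_∣) (sym (p─⊥≡p p))
∣p∣≡suc∣p-x∣ {p = true  ∷ _} (there x∈) = cong suc (∣p∣≡suc∣p-x∣ x∈)
∣p∣≡suc∣p-x∣ {p = false ∷ _} (there x∈) = ∣p∣≡suc∣p-x∣ x∈

∣p∪⁅x⁆∣≡suc∣p∣ : x ∉ p → ∣ p ∪ ⁅ x ⁆ ∣ ≡ suc ∣ p ∣
∣p∪⁅x⁆∣≡suc∣p∣ {x = zero}  {true  ∷ _} x∉ = contradiction here x∉
∣p∪⁅x⁆∣≡suc∣p∣ {x = zero}  {false ∷ p} _  = cong (suc ∘ ∣_∣) (∪-identityʳ p)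
∣p∪⁅x⁆∣≡suc∣p∣ {x = suc _} {true  ∷ _} x∉ = cong suc (∣p∪⁅x⁆∣≡suc∣p∣ (x∉ ∘ there))
∣p∪⁅x⁆∣≡suc∣p∣ {x = suc _} {false ∷ _} x∉ = ∣p∪⁅x⁆∣≡suc∣p∣ (x∉ ∘ there)

x∈p⇒0<∣p∣ : x ∈ p → 0 < ∣ p ∣
x∈p⇒0<∣p∣ x∈ = ≤-<-trans z≤n (x∈p⇒∣p-x∣<∣p∣ x∈)

Empty⇒∣p∣≡0 : {p : Subset n} → Empty p → ∣ p ∣ ≡ 0
Empty⇒∣p∣≡0 {n} ∅ = trans (cong ∣_∣ (Empty-unique ∅)) (∣⊥∣≡0 n)

0<∣p∣⇒Nonempty : 0 < ∣ p ∣ → Nonempty p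
0<∣p∣⇒Nonempty {p = p} 0< with nonempty? p
... | yes ne = ne
... | no  ∅  = contradiction (subst (0 <_) (Empty⇒∣p∣≡0 ∅) 0<) λ ()

p⊆q∧∣q∣≤∣p∣⇒p≡q : p ⊆ q → ∣ q ∣ ≤ ∣ p ∣ → p ≡ q
p⊆q∧∣q∣≤∣p∣⇒p≡q {p = p} p⊆q ∣q∣≤∣p∣ = ⊆-antisym p⊆q q⊆p
  where
  q⊆p : _ ⊆ p
  q⊆p {x} x∈q with x ∈? p
  ... | yes x∈p = x∈p
  ... | no  x∉p = contradiction (p⊂q⇒∣p∣<∣q∣ (p⊆q , x , x∈q , x∉p)) (≤⇒≯ ∣q∣≤∣p∣)

p∪⁅x⁆⊆q : p ⊆ q → x ∈ q → p ∪ ⁅ x ⁆ ⊆ q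
p∪⁅x⁆⊆q {p = p} {x = x} p⊆q x∈q y∈ with x∈p∪q⁻ p ⁅ x ⁆ y∈
... | inj₁ y∈p = p⊆q y∈p
... | inj₂ y∈x = subst (_∈ _) (sym (x∈⁅y⁆⇒x≡y x y∈x)) x∈q

x∈p∪⁅x⁆ : x ∈ p ∪ ⁅ x ⁆
x∈p∪⁅x⁆ {x = x} {p} = q⊆p∪q p ⁅ x ⁆ (x∈⁅x⁆ x)

p⊆q-x : p ⊆ q → x ∉ p → p ⊆ q - x
p⊆q-x p⊆q x∉p y∈p = x∈p∧x≢y⇒x∈p-y (p⊆q y∈p) λ { refl → x∉p y∈p }

∣p∣≡1⁻ : ∣ p ∣ ≡ 1 → ∃[ x ] x ∈ p × (∀ {y} → y ∈ p → y ≡ x)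
∣p∣≡1⁻ {p = p} ∣p∣≡1 with 0<∣p∣⇒Nonempty {p = p} (subst (0 <_) (sym ∣p∣≡1) (s≤s z≤n))
... | x , x∈p = x , x∈p , unique
  where
  unique : ∀ {y} → y ∈ p → y ≡ x
  unique {y} y∈p with y Fin.≟ x
  ... | yes y≡x = y≡x
  ... | no  y≢x = contradiction
    (subst (0 <_) (suc-injective (trans (sym (∣p∣≡suc∣p-x∣ x∈p)) ∣p∣≡1)) (x∈p⇒0<∣p∣ (x∈p∧x≢y⇒x∈p-y y∈p y≢x)))
    λ ()

∣p∣≡1⁺ : x ∈ p → (∀ {y} → y ∈ p → y ≡ x) → ∣ p ∣ ≡ 1
∣p∣≡1⁺ {x = x} {p} x∈p unique = trans (∣p∣≡suc∣p-x∣ x∈p) (cong suc (Empty⇒∣p∣≡0 ∅))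
  where
  ∅ : Empty (p - x)
  ∅ (y , y∈) with x∈p-y⁻ y∈
  ... | y∈p , y≢x = y≢x (unique y∈p)

-- Unique unions

does⇒ : ∀ {A : Set} (a? : Dec A) → does a? ≡ true → A
does⇒ (yes a) _ = a

module _ (C : Vec (Subset n) g) where

  ∈indicesOf⁺ : ∀ {e i} → e ∈ lookup C i → i ∈ indicesOf C e
  ∈indicesOf⁺ {e} {i} e∈ = lookup⇒[]= i _ (trans (lookup-map i _ C) ([]=⇒lookup e∈))

  ∈indicesOf⁻ : ∀ {e i} → i ∈ indicesOf C e → e ∈ lookup C i
  ∈indicesOf⁻ {e} {i} i∈ = lookup⇒[]= e _ (trans (sym (lookup-map i _ C)) ([]=⇒lookup i∈))

  -- The witness form of membership in a unique union. It names the owner `i` of `e`, which the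
  -- count in `uniqueUnion` hides.
  Only : Subset g → Fin n → Fin g → Set
  Only σ e i = i ∈ σ × e ∈ lookup C i × (∀ {j} → j ∈ σ → e ∈ lookup C j → j ≡ i)

  uniqueUnion⁻ : ∀ {σ e} → e ∈ uniqueUnion C σ → ∃ (Only σ e)
  uniqueUnion⁻ {σ} {e} e∈
    with ∣p∣≡1⁻ {p = σ ∩ indicesOf C e}
           (does⇒ (∣ σ ∩ indicesOf C e ∣ ≟ 1) (trans (sym (lookup∘tabulate _ e)) ([]=⇒lookup e∈)))
  ... | i , i∈ , unique with x∈p∩q⁻ σ _ i∈
  ...   | i∈σ , e∈i =
    i , i∈σ , ∈indicesOf⁻ e∈i , λ j∈σ e∈j → unique (x∈p∩q⁺ (j∈σ , ∈indicesOf⁺ e∈j))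

  uniqueUnion⁺ : ∀ {σ e i} → Only σ e i → e ∈ uniqueUnion C σ
  uniqueUnion⁺ {σ} {e} (i∈σ , e∈i , unique) =
    lookup⇒[]= e _ (trans (lookup∘tabulate _ e) (dec-true (∣ σ ∩ indicesOf C e ∣ ≟ 1) ∣∣≡1))
    where
    ∣∣≡1 : ∣ σ ∩ indicesOf C e ∣ ≡ 1
    ∣∣≡1 = ∣p∣≡1⁺ (x∈p∩q⁺ (i∈σ , ∈indicesOf⁺ e∈i)) λ j∈ →
      let (j∈σ , e∈j) = x∈p∩q⁻ σ _ j∈ in unique j∈σ (∈indicesOf⁻ e∈j)

  -- Fewer indices mean fewer competitors for `e`. Private parts therefore grow when the index set
  -- shrinks around a fixed owner.
  Only-⊆ : ∀ {σ τ e i} → τ ⊆ σ → i ∈ τ → Only σ e i → Only τ e i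
  Only-⊆ τ⊆σ i∈τ (_ , e∈i , unique) = i∈τ , e∈i , λ j∈τ → unique (τ⊆σ j∈τ)

  private-part : Subset g → Fin g → Subset n
  private-part σ i = lookup C i ∩ uniqueUnion C σ

  ∈private⁺ : ∀ {σ e i} → Only σ e i → e ∈ private-part σ i
  ∈private⁺ o@(_ , e∈i , _) = x∈p∩q⁺ (e∈i , uniqueUnion⁺ o)

  ∈private⁻ : ∀ {σ e i} → i ∈ σ → e ∈ private-part σ i → Only σ e i
  ∈private⁻ {σ} {e} {i} i∈σ e∈ with x∈p∩q⁻ (lookup C i) _ e∈
  ... | e∈i , e∈U with uniqueUnion⁻ e∈U
  ...   | k , o@(_ , _ , unique) = subst (Only σ e) (sym (unique i∈σ e∈i)) o

  remove : Fin g → Fin n → Vec (Subset n) g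
  remove i e = C [ i ]%= (_- e)

  ∈remove⁻ : ∀ {i e j x} → x ∈ lookup (remove i e) j → x ∈ lookup C j × ¬ (j ≡ i × x ≡ e)
  ∈remove⁻ {i} {e} {j} {x} x∈ with j Fin.≟ i
  ... | no j≢i = subst (x ∈_) (lookup∘updateAt′ j i j≢i C) x∈ , λ (j≡i , _) → j≢i j≡i
  ... | yes refl with x∈p-y⁻ (subst (x ∈_) (lookup∘updateAt i C) x∈)
  ...   | x∈i , x≢e = x∈i , λ (_ , x≡e) → x≢e x≡e

  ∈remove⁺ : ∀ {i e j x} → x ∈ lookup C j → ¬ (j ≡ i × x ≡ e) → x ∈ lookup (remove i e) j
  ∈remove⁺ {i} {e} {j} {x} x∈j ¬eq with j Fin.≟ i
  ... | no j≢i   = subst (x ∈_) (sym (lookup∘updateAt′ j i j≢i C)) x∈j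
  ... | yes refl = subst (x ∈_) (sym (lookup∘updateAt i C)) (x∈p∧x≢y⇒x∈p-y x∈j λ x≡e → ¬eq (refl , x≡e))


-- Coparking functions on a set of indices

module _ (C : Vec (Subset n) g) {σ e i} (sel : Only C σ e i) {τ} (τ⊆σ : τ ⊆ σ) where

  private
    C′ : Vec (Subset n) g
    C′ = remove C i e

  -- Within `σ` only `C i` contains `e`, so taking it out of that one set erases it from the unique
  -- union of every `τ ⊆ σ` and creates no new private element.
  Only-remove⁻ : ∀ {x j} → Only (remove C i e) τ x j → Only C τ x j × x ≢ e
  Only-remove⁻ {x} {j} (j∈τ , x∈ , unique) with ∈remove⁻ C x∈
  ... | x∈j , ¬eq = (j∈τ , x∈j , λ k∈τ x∈k → unique k∈τ (∈remove⁺ C x∈k (x≢e ∘ proj₂))) , x≢e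
    where
    x≢e : x ≢ e
    x≢e refl = ¬eq (proj₂ (proj₂ sel) (τ⊆σ j∈τ) x∈j , refl)

  Only-remove⁺ : ∀ {x j} → Only C τ x j → x ≢ e → Only (remove C i e) τ x j
  Only-remove⁺ (j∈τ , x∈j , unique) x≢e =
    j∈τ , ∈remove⁺ C x∈j (x≢e ∘ proj₂) , λ k∈τ → unique k∈τ ∘ proj₁ ∘ ∈remove⁻ C

  ∣private-remove∣-≢ : ∀ {j} → j ∈ τ → j ≢ i → ∣ private-part (remove C i e) τ j ∣ ≡ ∣ private-part C τ j ∣
  ∣private-remove∣-≢ {j} j∈τ j≢i = ≤-antisym
    (p⊆q⇒∣p∣≤∣q∣ {p = private-part C′ τ j} λ x∈ →
      ∈private⁺ C (proj₁ (Only-remove⁻ (∈private⁻ C′ j∈τ x∈))))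
    (p⊆q⇒∣p∣≤∣q∣ {q = private-part C′ τ j} λ x∈ → let o = ∈private⁻ C j∈τ x∈ in
      ∈private⁺ C′ (Only-remove⁺ o λ { refl → j≢i (proj₂ (proj₂ sel) (τ⊆σ j∈τ) (proj₁ (proj₂ o))) }))

  -- `e` is private to `i` in every `τ ⊆ σ` containing `i`. The resulting loss of exactly one
  -- element is what a decrement of `a_i` compensates.
  ∣private-remove∣-≡ : i ∈ τ → suc ∣ private-part (remove C i e) τ i ∣ ≡ ∣ private-part C τ i ∣
  ∣private-remove∣-≡ i∈τ =
    trans (cong (suc ∘ ∣_∣) (⊆-antisym ⊆⁻ ⊆⁺)) (sym (∣p∣≡suc∣p-x∣ (∈private⁺ C (Only-⊆ C τ⊆σ i∈τ sel))))
    where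
    ⊆⁻ : private-part (remove C i e) τ i ⊆ private-part C τ i - e
    ⊆⁻ x∈ with Only-remove⁻ (∈private⁻ C′ i∈τ x∈)
    ... | o , x≢e = x∈p∧x≢y⇒x∈p-y (∈private⁺ C o) x≢e

    ⊆⁺ : private-part C τ i - e ⊆ private-part (remove C i e) τ i
    ⊆⁺ x∈ with x∈p-y⁻ x∈
    ... | x∈′ , x≢e = ∈private⁺ C′ (Only-remove⁺ (∈private⁻ C i∈τ x∈′) x≢e)

CoparkingOn : Vec (Subset n) g → Subset g → Vec ℕ g → Set
CoparkingOn C σ a = ∀ τ → τ ⊆ σ → Nonempty τ → ∃[ i ] i ∈ τ × lookup a i < ∣ private-part C τ i ∣

-- `CoparkingOn` leaves the coordinates outside `σ` free. Fixing them at 0 gives each coparking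
-- function of a minor one representative in the same `Vec ℕ g`, with no reindexing after a
-- deletion.
ZeroOff : Subset g → Vec ℕ g → Set
ZeroOff σ a = ∀ {i} → i ∉ σ → lookup a i ≡ 0

lookup-inc : (a : Vec ℕ g) (i : Fin g) → lookup (a [ i ]%= suc) i ≡ suc (lookup a i)
lookup-inc a i = lookup∘updateAt i a

module _ (C : Vec (Subset n) g) where

  coparkingOn-⊆ : ∀ {σ τ a} → τ ⊆ σ → CoparkingOn C σ a → CoparkingOn C τ a
  coparkingOn-⊆ τ⊆σ cop υ υ⊆τ = cop υ (τ⊆σ ∘ υ⊆τ)

  coparkingOn-≤ : ∀ {σ a b} → (∀ i → lookup b i ≤ lookup a i) → CoparkingOn C σ a → CoparkingOn C σ b
  coparkingOn-≤ b≤a cop τ τ⊆σ ne with cop τ τ⊆σ ne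
  ... | i , i∈τ , aᵢ< = i , i∈τ , ≤-<-trans (b≤a i) aᵢ<

  coparkingOn⇒Nonempty : ∀ {σ a} → CoparkingOn C σ a → Nonempty σ → Nonempty (uniqueUnion C σ)
  coparkingOn⇒Nonempty {σ} cop ne with cop σ id ne
  ... | i , i∈σ , aᵢ< with 0<∣p∣⇒Nonempty {p = private-part C σ i} (≤-<-trans z≤n aᵢ<)
  ...   | e , e∈ = e , proj₂ (x∈p∩q⁻ (lookup C i) _ e∈)

  module _ {σ e i} (sel : Only C σ e i) where

    -- For `τ` containing `i`, the element `e` alone makes the private part of `i` larger than
    -- `a_i = 0`; the other `τ` lie in `σ - i`.
    coparkingOn-delete : ∀ {a} → lookup a i ≡ 0 → CoparkingOn C (σ - i) a → CoparkingOn C σ a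
    coparkingOn-delete {a} aᵢ≡0 cop τ τ⊆σ ne with i ∈? τ
    ... | no  i∉τ = cop τ (p⊆q-x τ⊆σ i∉τ) ne
    ... | yes i∈τ = i , i∈τ ,
      subst (_< _) (sym aᵢ≡0) (x∈p⇒0<∣p∣ (∈private⁺ C (Only-⊆ C τ⊆σ i∈τ sel)))

    coparkingOn-contract⁺ : ∀ {a} → CoparkingOn (remove C i e) σ a → CoparkingOn C σ (a [ i ]%= suc)
    coparkingOn-contract⁺ {a} cop τ τ⊆σ ne with cop τ τ⊆σ ne
    ... | j , j∈τ , aⱼ< with j Fin.≟ i
    ...   | yes refl = i , j∈τ ,
      subst₂ _<_ (sym (lookup-inc a i)) (∣private-remove∣-≡ C sel τ⊆σ j∈τ) (s≤s aⱼ<)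
    ...   | no  j≢i  = j , j∈τ ,
      subst₂ _<_ (sym (lookup∘updateAt′ j i j≢i a)) (∣private-remove∣-≢ C sel τ⊆σ j∈τ j≢i) aⱼ<

    coparkingOn-contract⁻ : ∀ {a} → CoparkingOn C σ (a [ i ]%= suc) → CoparkingOn (remove C i e) σ a
    coparkingOn-contract⁻ {a} cop τ τ⊆σ ne with cop τ τ⊆σ ne
    ... | j , j∈τ , aⱼ< with j Fin.≟ i
    ...   | yes refl = i , j∈τ ,
      ≤-pred (subst₂ _<_ (lookup-inc a i) (sym (∣private-remove∣-≡ C sel τ⊆σ j∈τ)) aⱼ<)
    ...   | no  j≢i  = j , j∈τ ,
      subst₂ _<_ (lookup∘updateAt′ j i j≢i a) (sym (∣private-remove∣-≢ C sel τ⊆σ j∈τ j≢i)) aⱼ<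

inc∘pred : ∀ (a : Vec ℕ g) {i m} → lookup a i ≡ suc m → (a [ i ]%= pred) [ i ]%= suc ≡ a
inc∘pred a {i} aᵢ≡ = trans
  (updateAt-updateAt-local i {f = suc} {g = pred} {h = id} a
    (trans (cong (λ k → suc (pred k)) aᵢ≡) (sym aᵢ≡)))
  (updateAt-id-local i a refl)

-- Induction over deletion and contraction steps

weight : Subset g → Vec (Subset n) g → ℕ
weight σ C = ∣ σ ∣ + sum (Vec.map ∣_∣ C)

sum-map-remove : ∀ (C : Vec (Subset n) g) {i e} → e ∈ lookup C i →
                 sum (Vec.map ∣_∣ (remove C i e)) < sum (Vec.map ∣_∣ C)
sum-map-remove (A ∷ C) {zero}  e∈A = +-monoˡ-< (sum (Vec.map ∣_∣ C)) (x∈p⇒∣p-x∣<∣p∣ e∈A)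
sum-map-remove (A ∷ C) {suc _} e∈  = +-monoʳ-< ∣ A ∣ (sum-map-remove C e∈)

-- Both steps lower `weight`: a deletion shrinks `σ`, a contraction takes an element out of one set.
-- One principle thus serves termination, the construction of runs, the enumeration and the raising
-- argument for purity.
deletion-contraction-induction :
  (P : Subset g → Vec (Subset n) g → Set) →
  (∀ σ C → (∀ {i} → i ∈ σ → P (σ - i) C) → (∀ {i e} → e ∈ lookup C i → P σ (remove C i e)) → P σ C) →
  ∀ σ C → P σ C
deletion-contraction-induction P step σ C = go (suc (weight σ C)) σ C ≤-refl
  where
  go : ∀ k σ C → weight σ C < k → P σ C
  go (suc k) σ C (s≤s w≤k) = step σ C
    (λ i∈σ → go k _ _ (<-≤-trans (+-monoˡ-< _ (x∈p⇒∣p-x∣<∣p∣ i∈σ)) w≤k))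
    (λ e∈  → go k _ _ (<-≤-trans (+-monoʳ-< ∣ σ ∣ (sum-map-remove C e∈)) w≤k))

-- Matroids

∈-allSubsets : (A : Subset n) → A List.∈ allSubsets n
∈-allSubsets []          = here refl
∈-allSubsets (false ∷ A) = ∈-++⁺ˡ (∈-map⁺ _ (∈-allSubsets A))
∈-allSubsets (true  ∷ A) = ∈-++⁺ʳ _ (∈-map⁺ _ (∈-allSubsets A))

module _ (M : Matroid n) where
  open Matroid M

  ∣indep∣≤rank : ∀ {I} → Indep I → ∣ I ∣ ≤ rank M
  ∣indep∣≤rank {I} ind = All.lookup (Extrema.xs≤max 0 (map ∣_∣ (independentSets M)))
    (∈-map⁺ ∣_∣ (∈-filter⁺ indep? (∈-allSubsets I) ind))

  maximumIndep : ∃[ I ] Indep I × ∣ I ∣ ≡ rank M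
  maximumIndep = Extrema.argmax-all id {P = λ k → ∃[ I ] Indep I × ∣ I ∣ ≡ k} (⊥ , ⊥-indep , ∣⊥∣≡0 n)
    (All.tabulate size)
    where
    size : ∀ {k} → k List.∈ map ∣_∣ (independentSets M) → ∃[ I ] Indep I × ∣ I ∣ ≡ k
    size k∈ with ∈-map⁻ ∣_∣ k∈
    ... | I , I∈ , refl = I , proj₂ (∈-filter⁻ indep? {xs = allSubsets n} I∈) , refl

  rank≤n : rank M ≤ n
  rank≤n with maximumIndep
  ... | I , _ , ∣I∣≡rank = subst (_≤ n) ∣I∣≡rank (∣p∣≤n I)

  basis⇒∣∣≡rank : ∀ {B} → IsBasis M B → ∣ B ∣ ≡ rank M
  basis⇒∣∣≡rank {B} (ind , maximal) with maximumIndep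
  ... | J , indJ , ∣J∣≡rank with ∣ B ∣ <? ∣ J ∣
  ...   | no  ≮ = ≤-antisym (∣indep∣≤rank ind) (subst (_≤ ∣ B ∣) ∣J∣≡rank (≮⇒≥ ≮))
  ...   | yes < with exchange ind indJ <
  ...     | e , _ , e∉B , ind′ =
    contradiction (subst (e ∈_) (maximal ind′ (p⊆p∪q ⁅ e ⁆)) x∈p∪⁅x⁆) e∉B

  ∣∣≡rank⇒basis : ∀ {B} → Indep B → ∣ B ∣ ≡ rank M → IsBasis M B
  ∣∣≡rank⇒basis ind ∣B∣≡rank = ind , λ indI B⊆I →
    sym (p⊆q∧∣q∣≤∣p∣⇒p≡q B⊆I (subst (_ ≤_) (sym ∣B∣≡rank) (∣indep∣≤rank indI)))

  augment : ∀ {I J} → Indep I → Indep J → ∃[ A ] Indep A × I ⊆ A × A ⊆ I ∪ J × ∣ J ∣ ≤ ∣ A ∣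
  -- Each exchange adds one element, so `k` bounds the exchanges still needed; at `k = 0` the
  -- invariant `∣ J ∣ ≤ ∣ A ∣ + k` is the goal.
  augment {I} {J} indI indJ = go ∣ J ∣ indI id (p⊆p∪q J) (m≤n+m ∣ J ∣ ∣ I ∣)
    where
    go : ∀ k {A} → Indep A → I ⊆ A → A ⊆ I ∪ J → ∣ J ∣ ≤ ∣ A ∣ + k →
         ∃[ A ] Indep A × I ⊆ A × A ⊆ I ∪ J × ∣ J ∣ ≤ ∣ A ∣
    go zero {A} indA I⊆A A⊆ ≤+ = A , indA , I⊆A , A⊆ , subst (∣ J ∣ ≤_) (+-identityʳ ∣ A ∣) ≤+
    go (suc k) {A} indA I⊆A A⊆ ≤+ with ∣ A ∣ <? ∣ J ∣
    ... | no  ≮ = A , indA , I⊆A , A⊆ , ≮⇒≥ ≮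
    ... | yes < with exchange indA indJ <
    ...   | e , e∈J , e∉A , ind′ = go k ind′ (p⊆p∪q ⁅ e ⁆ ∘ I⊆A) (p∪⁅x⁆⊆q A⊆ (q⊆p∪q I J e∈J))
      (subst (∣ J ∣ ≤_) (trans (+-suc ∣ A ∣ k) (cong (_+ k) (sym (∣p∪⁅x⁆∣≡suc∣p∣ e∉A)))) ≤+)

  -- `Z - e` is independent and can be augmented from `I` inside `S`. The result contains `Z - e`,
  -- so it cannot also contain `e`. Hence deleting `e` from `S` does not lower the rank.
  avoid-circuit-element : ∀ {Z S I e} → IsCircuit M Z → Z ⊆ S → e ∈ Z → Indep I → I ⊆ S →
                          ∃[ J ] Indep J × J ⊆ S - e × ∣ I ∣ ≤ ∣ J ∣
  avoid-circuit-element {Z} {S} {I} {e} (dep , minimal) Z⊆S e∈Z indI I⊆S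
    with augment (minimal (x∈p⇒p-x⊂p e∈Z)) indI
  ... | J , indJ , Z-e⊆J , J⊆ , ∣I∣≤∣J∣ = J , indJ , p⊆q-x J⊆S e∉J , ∣I∣≤∣J∣
    where
    J⊆S : J ⊆ S
    J⊆S x∈J with x∈p∪q⁻ (Z - e) I (J⊆ x∈J)
    ... | inj₁ x∈Z = Z⊆S (proj₁ (x∈p-y⁻ x∈Z))
    ... | inj₂ x∈I = I⊆S x∈I

    e∉J : e ∉ J
    e∉J e∈J = dep (hereditary Z⊆J indJ)
      where
      Z⊆J : Z ⊆ J
      Z⊆J {x} x∈Z with x Fin.≟ e
      ... | yes refl = e∈J
      ... | no  x≢e  = Z-e⊆J (x∈p∧x≢y⇒x∈p-y x∈Z x≢e)

  cycle⇒circuit : ∀ {C e} → IsCycle M C → e ∈ C → ∃[ Z ] IsCircuit M Z × Z ⊆ C × e ∈ Z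
  cycle⇒circuit (Ds , circuits , refl) = go Ds circuits
    where
    go : ∀ Ds {e} → All (IsCircuit M) Ds → e ∈ ⋃ Ds → ∃[ Z ] IsCircuit M Z × Z ⊆ ⋃ Ds × e ∈ Z
    go []       _                  e∈ = contradiction e∈ ∉⊥
    go (D ∷ Ds) (circuit ∷ rest) e∈ with x∈p∪q⁻ D (⋃ Ds) e∈
    ... | inj₁ e∈D = D , circuit , p⊆p∪q (⋃ Ds) , e∈D
    ... | inj₂ e∈⋃ with go Ds rest e∈⋃
    ...   | Z , circuitZ , Z⊆ , e∈Z = Z , circuitZ , q⊆p∪q D (⋃ Ds) ∘ Z⊆ , e∈Z

-- Minors reached by deleting and contracting selected elements

module Minors (M : Matroid n) (C₀ : Vec (Subset n) g) (cycles : ∀ i → IsCycle M (lookup C₀ i)) where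
  open Matroid M

  -- The minor with the elements outside S deleted and those of K contracted,
  -- for which the sets C j with j ∈ σ form a cycle system.
  record IsMinor (σ : Subset g) (C : Vec (Subset n) g) (S K : Subset n) : Set where
    field
      K⊆S       : K ⊆ S
      ∣S∣       : ∣ S ∣ ≡ ∣ σ ∣ + rank M
      spanning  : ∃[ I ] Indep I × I ⊆ S × rank M ≤ ∣ I ∣
      C₀⊆S      : ∀ {j} → j ∈ σ → lookup C₀ j ⊆ S
      C⊆C₀      : ∀ {j} → j ∈ σ → lookup C j ⊆ lookup C₀ j
      C₀⊆C∪K    : ∀ {j x} → j ∈ σ → x ∈ lookup C₀ j → x ∈ lookup C j ⊎ x ∈ K
      C∩K       : ∀ {j x} → j ∈ σ → x ∈ lookup C j → x ∉ K
      dependent : ∀ {τ} → τ ⊆ σ → Nonempty τ → Dependent (uniqueUnion C τ ∪ K)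

  module _ {σ C S K} (minor : IsMinor σ C S K) where
    open IsMinor minor

    -- With an empty unique union, `dependent` at `τ = σ` would say that `K` itself is dependent.
    indep⇒Nonempty : Indep K → Nonempty σ → Nonempty (uniqueUnion C σ)
    indep⇒Nonempty indK ne with nonempty? (uniqueUnion C σ)
    ... | yes ne′ = ne′
    ... | no  ∅   = contradiction (subst (λ U → Indep (U ∪ K)) (sym (Empty-unique ∅))
      (subst Indep (sym (∪-identityˡ K)) indK)) (dependent id ne)

    module _ (∅ : Empty σ) where

      ∣S∣≡rank : ∣ S ∣ ≡ rank M
      ∣S∣≡rank = trans ∣S∣ (cong (_+ rank M) (Empty⇒∣p∣≡0 ∅))

      S-indep : Indep S
      S-indep with spanning
      ... | I , indI , I⊆S , rank≤∣I∣ =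
        subst Indep (p⊆q∧∣q∣≤∣p∣⇒p≡q I⊆S (subst (_≤ ∣ I ∣) (sym ∣S∣≡rank) rank≤∣I∣)) indI

      spanning-⊆ : ∀ {B} → B ⊆ S → ∣ B ∣ ≡ rank M → B ≡ S
      spanning-⊆ B⊆S ∣B∣ = p⊆q∧∣q∣≤∣p∣⇒p≡q B⊆S (≤-reflexive (trans ∣S∣≡rank (sym ∣B∣)))

    module _ {e i} (sel : Only C σ e i) where

      private
        i∈σ : i ∈ σ
        i∈σ = proj₁ sel

        e∈i : e ∈ lookup C i
        e∈i = proj₁ (proj₂ sel)

        unique : ∀ {j} → j ∈ σ → e ∈ lookup C j → j ≡ i
        unique = proj₂ (proj₂ sel)

      e∈S : e ∈ S
      e∈S = C₀⊆S i∈σ (C⊆C₀ i∈σ e∈i)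

      e∉K : e ∉ K
      e∉K = C∩K i∈σ e∈i

      σ-i⊆σ : σ - i ⊆ σ
      σ-i⊆σ = proj₁ ∘ x∈p-y⁻

      delete : IsMinor (σ - i) C (S - e) K
      delete = record
        { K⊆S       = p⊆q-x K⊆S e∉K
        ; ∣S∣       = suc-injective (trans (sym (∣p∣≡suc∣p-x∣ e∈S))
            (trans ∣S∣ (cong (_+ rank M) (∣p∣≡suc∣p-x∣ i∈σ))))
        ; spanning  = spanning′
        ; C₀⊆S      = λ j∈ → p⊆q-x (C₀⊆S (σ-i⊆σ j∈)) (e∉C₀ j∈)
        ; C⊆C₀      = C⊆C₀ ∘ σ-i⊆σ
        ; C₀⊆C∪K    = C₀⊆C∪K ∘ σ-i⊆σ
        ; C∩K       = C∩K ∘ σ-i⊆σ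
        ; dependent = λ τ⊆ → dependent (σ-i⊆σ ∘ τ⊆)
        }
        where
        -- The original cycles of the remaining indices must survive the deletion. An element of
        -- `C₀ j` missing from `C j` has been contracted, and `e` has not.
        e∉C₀ : ∀ {j} → j ∈ σ - i → e ∉ lookup C₀ j
        e∉C₀ j∈ e∈C₀ with C₀⊆C∪K (σ-i⊆σ j∈) e∈C₀
        ... | inj₁ e∈C = proj₂ (x∈p-y⁻ j∈) (unique (σ-i⊆σ j∈) e∈C)
        ... | inj₂ e∈K = e∉K e∈K

        spanning′ : ∃[ I ] Indep I × I ⊆ S - e × rank M ≤ ∣ I ∣
        -- The shrunk `C i` need not be a cycle of `M`. The original `C₀ i` is one and still lies in
        -- `S`, so it supplies the circuit through `e`.
        spanning′ with spanning | cycle⇒circuit M (cycles i) (C⊆C₀ i∈σ e∈i)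
        ... | I , indI , I⊆S , rank≤ | Z , circuit , Z⊆ , e∈Z
          with avoid-circuit-element M circuit (λ x∈Z → C₀⊆S i∈σ (Z⊆ x∈Z)) e∈Z indI I⊆S
        ...   | J , indJ , J⊆ , ∣I∣≤∣J∣ = J , indJ , J⊆ , ≤-trans rank≤ ∣I∣≤∣J∣

      -- `S` is untouched, so size and spanning carry over. Dependence carries over because `e`
      -- leaves the unique unions but joins `K`; this holds whether or not `K ∪ ⁅ e ⁆` is
      -- independent.
      contract : IsMinor σ (remove C i e) S (K ∪ ⁅ e ⁆)
      contract = record
        { K⊆S       = p∪⁅x⁆⊆q K⊆S e∈S
        ; ∣S∣       = ∣S∣
        ; spanning  = spanning
        ; C₀⊆S      = C₀⊆S
        ; C⊆C₀      = λ j∈σ x∈ → C⊆C₀ j∈σ (proj₁ (∈remove⁻ C x∈))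
        ; C₀⊆C∪K    = C₀⊆C∪K′
        ; C∩K       = C∩K′
        ; dependent = λ {τ} τ⊆σ ne ind → dependent τ⊆σ ne (hereditary (U⊆ τ⊆σ) ind)
        }
        where
        C₀⊆C∪K′ : ∀ {j x} → j ∈ σ → x ∈ lookup C₀ j → x ∈ lookup (remove C i e) j ⊎ x ∈ K ∪ ⁅ e ⁆
        C₀⊆C∪K′ {j} {x} j∈σ x∈ with C₀⊆C∪K j∈σ x∈ | x Fin.≟ e
        ... | inj₂ x∈K | _        = inj₂ (p⊆p∪q ⁅ e ⁆ x∈K)
        ... | inj₁ _   | yes refl = inj₂ x∈p∪⁅x⁆
        ... | inj₁ x∈C | no x≢e   = inj₁ (∈remove⁺ C x∈C (x≢e ∘ proj₂))

        C∩K′ : ∀ {j x} → j ∈ σ → x ∈ lookup (remove C i e) j → x ∉ K ∪ ⁅ e ⁆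
        C∩K′ {j} {x} j∈σ x∈ x∈K′ with ∈remove⁻ C x∈ | x∈p∪q⁻ K ⁅ e ⁆ x∈K′
        ... | x∈j , _   | inj₁ x∈K = C∩K j∈σ x∈j x∈K
        ... | x∈j , ¬eq | inj₂ x∈e with x∈⁅y⁆⇒x≡y e x∈e
        ...   | refl = ¬eq (unique j∈σ x∈j , refl)

        U⊆ : ∀ {τ} → τ ⊆ σ → uniqueUnion C τ ∪ K ⊆ uniqueUnion (remove C i e) τ ∪ (K ∪ ⁅ e ⁆)
        U⊆ {τ} τ⊆σ {x} x∈ with x∈p∪q⁻ (uniqueUnion C τ) K x∈ | x Fin.≟ e
        ... | inj₂ x∈K | _        = q⊆p∪q (uniqueUnion (remove C i e) τ) _ (p⊆p∪q ⁅ e ⁆ x∈K)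
        ... | inj₁ _   | yes refl = q⊆p∪q (uniqueUnion (remove C i e) τ) _ x∈p∪⁅x⁆
        ... | inj₁ x∈U | no  x≢e  = p⊆p∪q _
          (uniqueUnion⁺ (remove C i e) (Only-remove⁺ C sel τ⊆σ (proj₂ (uniqueUnion⁻ C x∈U)) x≢e))

  -- Descend along `a`, deleting where `a_i = 0` and contracting otherwise. `K` only grows on the
  -- way, and at the end it sits inside an independent `S`.
  coparkingOn⇒indep : ∀ σ C {S K} a → IsMinor σ C S K → CoparkingOn C σ a → Indep K
  coparkingOn⇒indep = deletion-contraction-induction
    (λ σ C → ∀ {S K} a → IsMinor σ C S K → CoparkingOn C σ a → Indep K) step
    where
    step : ∀ σ C →
      (∀ {i} → i ∈ σ → ∀ {S K} a → IsMinor (σ - i) C S K → CoparkingOn C (σ - i) a → Indep K) →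
      (∀ {i e} → e ∈ lookup C i →
        ∀ {S K} a → IsMinor σ (remove C i e) S K → CoparkingOn (remove C i e) σ a → Indep K) →
      ∀ {S K} a → IsMinor σ C S K → CoparkingOn C σ a → Indep K
    step σ C del con a minor cop with nonempty? σ
    ... | no ∅ = hereditary (IsMinor.K⊆S minor) (S-indep minor ∅)
    ... | yes ne with uniqueUnion⁻ C (proj₂ (coparkingOn⇒Nonempty C {a = a} cop ne))
    ...   | i , sel@(i∈σ , e∈i , _) with lookup a i in aᵢ≡
    ...     | zero  = del i∈σ a (delete minor sel) (coparkingOn-⊆ C {a = a} (σ-i⊆σ minor sel) cop)
    ...     | suc _ = hereditary (p⊆p∪q _) (con e∈i (a [ i ]%= pred) (contract minor sel)
      (coparkingOn-contract⁻ C sel {a = a [ i ]%= pred} (subst (CoparkingOn C σ) (sym (inc∘pred a aᵢ≡)) cop)))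

initial-minor : (M : Matroid n) (C : Vec (Subset n) g) (cs : IsCycleSystem M C) →
                Minors.IsMinor M C (IsCycleSystem.cycles cs) ⊤ C ⊤ ⊥
initial-minor {n} {g} M C cs = record
  { K⊆S       = ⊥⊆
  ; ∣S∣       = begin
      ∣ ⊤ {n} ∣            ≡⟨ ∣⊤∣≡n n ⟩
      -- The corank is a truncated difference, so adding the rank back requires `rank M ≤ n`.
      n                    ≡⟨ sym (m∸n+n≡m (rank≤n M)) ⟩
      corank M + rank M    ≡⟨ cong (_+ rank M) (sym size-corank) ⟩
      g + rank M           ≡⟨ cong (_+ rank M) (sym (∣⊤∣≡n g)) ⟩
      ∣ ⊤ {g} ∣ + rank M   ∎
  ; spanning  = let (I , ind , ∣I∣) = maximumIndep M in I , ind , ⊆⊤ , ≤-reflexive (sym ∣I∣)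
  ; C₀⊆S      = λ _ → ⊆⊤
  ; C⊆C₀      = λ _ → id
  ; C₀⊆C∪K    = λ _ → inj₁
  ; C∩K       = λ _ _ → ∉⊥
  ; dependent = λ {τ} _ ne → subst (Matroid.Dependent M) (sym (∪-identityʳ _)) (dependent τ ne)
  }
  where
  open IsCycleSystem cs
  open ≡-Reasoning

-- The two procedures

increment-+ : (a b : Vec ℕ g) (i : Fin g) →
              Vec.zipWith _+_ (a [ i ]%= suc) b ≡ Vec.zipWith _+_ a (b [ i ]%= suc)
increment-+ (x ∷ a) (y ∷ b) zero    = cong (_∷ Vec.zipWith _+_ a b) (sym (+-suc x y))
increment-+ (x ∷ a) (y ∷ b) (suc i) = cong (_ ∷_) (increment-+ a b i)

increment-injective : (a b : Vec ℕ g) (i : Fin g) → a [ i ]%= suc ≡ b [ i ]%= suc → a ≡ b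
increment-injective (x ∷ a) (y ∷ b) zero    eq =
  cong₂ _∷_ (suc-injective (cong Vec.head eq)) (cong Vec.tail eq)
increment-injective (x ∷ a) (y ∷ b) (suc i) eq =
  cong₂ _∷_ (cong Vec.head eq) (increment-injective a b i (cong Vec.tail eq))

+-zeroes : (a : Vec ℕ g) → Vec.zipWith _+_ a (replicate g 0) ≡ a
+-zeroes []      = refl
+-zeroes (x ∷ a) = cong₂ _∷_ (+-identityʳ x) (+-zeroes a)

zeroes-+ : (a : Vec ℕ g) → Vec.zipWith _+_ (replicate g 0) a ≡ a
zeroes-+ []      = refl
zeroes-+ (x ∷ a) = cong (x ∷_) (zeroes-+ a)

zeroes-unique : (a : Vec ℕ g) → (∀ i → lookup a i ≡ 0) → a ≡ replicate g 0
zeroes-unique []      _  = refl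
zeroes-unique (x ∷ a) ≡0 = cong₂ _∷_ (≡0 zero) (zeroes-unique a (≡0 ∘ suc))

module _ {n g : ℕ} {_≼_ : Rel (Fin n) 0ℓ} (≼-isTotalOrder : IsTotalOrder _≡_ _≼_) where
  open IsTotalOrder ≼-isTotalOrder using () renaming (antisym to ≼-antisym)
  open Procedures {n} {g} _≼_

  private
    totalOrder : TotalOrder 0ℓ 0ℓ 0ℓ
    totalOrder = record { isTotalOrder = ≼-isTotalOrder }

  maximumElement : {p : Subset n} → Nonempty p → ∃[ e ] e ∈ p × (∀ {x} → x ∈ p → x ≼ e)
  maximumElement {p} (x , x∈p) = max x xs , argmax-all id x∈p (all-filter (_∈? p) (allFin n)) ,
    λ y∈p → All.lookup (xs≤max x xs) (∈-filter⁺ (_∈? p) (∈-allFin _) y∈p)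
    where
    open import Data.List.Extrema totalOrder
    xs : List (Fin n)
    xs = filter (_∈? p) (allFin n)

  module _ {X : Set} where

    selects⇒Only : ∀ {σ C} {x : X} {e i} → Selects ⟨ σ , C , x ⟩ (e , i) → Only C σ e i
    selects⇒Only {σ} {C} {e = e} (e∈U , _ , i∈σ , e∈i) with uniqueUnion⁻ C e∈U
    ... | k , o@(_ , _ , unique) = subst (Only C σ e) (sym (unique i∈σ e∈i)) o

    -- The variables `x` and `y` may differ because a selection reads only `σ` and `C`. Runs with
    -- different vectors can thus be compared step by step.
    selects-unique : ∀ {σ C} {x y : X} {s t} → Selects ⟨ σ , C , x ⟩ s → Selects ⟨ σ , C , y ⟩ t → s ≡ t
    selects-unique {σ} {C} {x} {y} sel@(e∈U , ≼e , i∈σ , e∈i) sel′@(e′∈U , ≼e′ , i′∈σ , e′∈i′)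
      with ≼-antisym (≼e′ e∈U) (≼e e′∈U)
    ... | refl = cong (_ ,_) (proj₂ (proj₂ (selects⇒Only {x = y} sel′)) i∈σ e∈i)

    select : ∀ {σ C} {x : X} → Nonempty (uniqueUnion C σ) → ∃! _≡_ (Selects ⟨ σ , C , x ⟩)
    select {σ} {C} {x} ne with maximumElement ne
    ... | e , e∈U , ≼e with uniqueUnion⁻ C e∈U
    ...   | i , i∈σ , e∈i , _ = (e , i) , sel , selects-unique {x = x} {y = x} sel
      where
      sel : Selects ⟨ σ , C , x ⟩ (e , i)
      sel = e∈U , ≼e , i∈σ , e∈i

    module _ (body : Fin n → Fin g → State n g X → State n g X) where
      open Loop body

      reachable-invariant : (Q : State n g X → Set) → (∀ {s t} → Q s → s ⟶ t → Q t) →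
                            ∀ {s t} → Q s → Star _⟶_ s t → Q t
      reachable-invariant Q pres q ε         = q
      reachable-invariant Q pres q (s⟶ ◅ ⟶*) = reachable-invariant Q pres (pres q s⟶) ⟶*

      endsWith-step : ∀ {e i s x} → Selects s (e , i) → EndsWith (body e i s) x → EndsWith s x
      endsWith-step sel (t , ⟶* , done) = t , step sel ◅ ⟶* , done

      -- Which branch a body takes may depend on the variables, but either branch lowers `weight`.
      -- This shape is common to both loops and is all that termination uses.
      DeletesOrContracts : Set
      DeletesOrContracts = ∀ e i σ C x → ∃ λ y →
        body e i ⟨ σ , C , x ⟩ ≡ ⟨ σ - i , C , y ⟩ ⊎ body e i ⟨ σ , C , x ⟩ ≡ ⟨ σ , remove C i e , y ⟩

      terminates : DeletesOrContracts → ∀ s → Terminates s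
      terminates shape ⟨ σ , C , x ⟩ = deletion-contraction-induction
        (λ σ C → ∀ x → Terminates ⟨ σ , C , x ⟩) (λ σ C del con x → acc (next σ C x del con)) σ C x
        where
        next : ∀ σ C x → (∀ {i} → i ∈ σ → ∀ y → Terminates ⟨ σ - i , C , y ⟩) →
               (∀ {i e} → e ∈ lookup C i → ∀ y → Terminates ⟨ σ , remove C i e , y ⟩) →
               ∀ {t} → ⟨ σ , C , x ⟩ ⟶ t → Terminates t
        next σ C x del con (step {e} {i} (_ , _ , i∈σ , e∈i)) with shape e i σ C x
        ... | y , inj₁ eq = subst Terminates (sym eq) (del i∈σ y)
        ... | y , inj₂ eq = subst Terminates (sym eq) (con e∈i y)

  -- A joint trace of the two procedures; a holds the increments still to come
  -- in the first and the decrements still allowed in the second.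
  data Run (B : Subset n) (σ : Subset g) (C : Vec (Subset n) g) : Vec ℕ g → Set where
    stop : Empty σ → Run B σ C (replicate g 0)
    drop : ∀ {e i a} → Selects ⟨ σ , C , a ⟩ (e , i) → e ∉ B → Run B (σ - i) C a → Run B σ C a
    keep : ∀ {e i a} → Selects ⟨ σ , C , a ⟩ (e , i) → e ∈ B → Run B σ (remove C i e) a →
           Run B σ C (a [ i ]%= suc)

  module _ {B : Subset n} where

    run⇒zeroOff : ∀ {σ C a} → Run B σ C a → ZeroOff σ a
    run⇒zeroOff (stop _) {i} _ = lookup-replicate i 0
    run⇒zeroOff (drop _ _ run) j∉σ = run⇒zeroOff run (j∉σ ∘ proj₁ ∘ x∈p-y⁻)
    run⇒zeroOff {σ} (keep {i = i} {a} (_ , _ , i∈σ , _) _ run) {j} j∉σ =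
      trans (lookup∘updateAt′ j i j≢i a) (run⇒zeroOff run j∉σ)
      where
      j≢i : j ≢ i
      j≢i refl = j∉σ i∈σ

    -- A dropped index is never selected again, so no increments remain for it. This zero is what
    -- distinguishes a `drop` from a `keep`.
    deleted⇒0 : ∀ {σ C a i} → Run B (σ - i) C a → lookup a i ≡ 0
    deleted⇒0 run = run⇒zeroOff run λ i∈ → proj₂ (x∈p-y⁻ i∈) refl

    run⇒coparkingOn : ∀ {σ C a} → Run B σ C a → CoparkingOn C σ a
    run⇒coparkingOn (stop ∅) τ τ⊆σ (i , i∈τ) = contradiction (i , τ⊆σ i∈τ) ∅
    run⇒coparkingOn {C = C} {a} (drop sel _ run) =
      coparkingOn-delete C (selects⇒Only {x = a} sel) {a = a} (deleted⇒0 run) (run⇒coparkingOn run)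
    run⇒coparkingOn {C = C} (keep {a = a} sel _ run) =
      coparkingOn-contract⁺ C (selects⇒Only {x = a} sel) {a = a} (run⇒coparkingOn run)

    run-deterministic : ∀ {σ C a b} → Run B σ C a → Run B σ C b → a ≡ b
    run-deterministic (stop _) (stop _) = refl
    run-deterministic (stop ∅) (drop (_ , _ , i∈σ , _) _ _) = contradiction (_ , i∈σ) ∅
    run-deterministic (stop ∅) (keep (_ , _ , i∈σ , _) _ _) = contradiction (_ , i∈σ) ∅
    run-deterministic (drop (_ , _ , i∈σ , _) _ _) (stop ∅) = contradiction (_ , i∈σ) ∅
    run-deterministic (keep (_ , _ , i∈σ , _) _ _) (stop ∅) = contradiction (_ , i∈σ) ∅
    run-deterministic {a = a} {b} (drop sel e∉B run) (drop sel′ _ run′)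
      with selects-unique {x = a} {y = b} sel sel′
    ... | refl = run-deterministic run run′
    run-deterministic {a = a} (drop sel e∉B run) (keep {a = b} sel′ e∈B _)
      with selects-unique {x = a} {y = b} sel sel′
    ... | refl = contradiction e∈B e∉B
    run-deterministic {b = b} (keep {a = a} sel e∈B _) (drop sel′ e∉B run)
      with selects-unique {x = a} {y = b} sel sel′
    ... | refl = contradiction e∈B e∉B
    run-deterministic (keep {i = i} {a} sel e∈B run) (keep {a = b} sel′ _ run′)
      with selects-unique {x = a} {y = b} sel sel′
    ... | refl = cong (_[ i ]%= suc) (run-deterministic run run′)

  -- From bases to coparking functions

  module _ (C₀ : Vec (Subset n) g) (B : Subset n) where
    open BasisToCoparking C₀ B
    open Loop body using (_⟶_; step; EndsWith)

    module _ {e : Fin n} {i : Fin g} {σ : Subset g} {C : Vec (Subset n) g} {a : Vec ℕ g} where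

      body-∈ : e ∈ B → body e i ⟨ σ , C , a ⟩ ≡ ⟨ σ , remove C i e , a [ i ]%= suc ⟩
      body-∈ e∈B = cong (if_then _ else _) (dec-true (e ∈? B) e∈B)

      body-∉ : e ∉ B → body e i ⟨ σ , C , a ⟩ ≡ ⟨ σ - i , C , a ⟩
      body-∉ e∉B = cong (if_then _ else _) (dec-false (e ∈? B) e∉B)

    basisToCoparking-terminates : Terminates
    basisToCoparking-terminates = terminates body shape start
      where
      shape : DeletesOrContracts body
      shape e i σ C a with e ∈? B
      ... | yes _ = _ , inj₂ refl
      ... | no  _ = _ , inj₁ refl

    -- Generalised over `b`, the increments already made when the loop reaches the state; the run
    -- contributes those still to come.
    run⇒basisToCoparking : ∀ {σ C a} b → Run B σ C a →
                           EndsWith ⟨ σ , C , b ⟩ (Vec.zipWith _+_ b a)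
    run⇒basisToCoparking b (stop ∅) = _ , ε , ∅ , sym (+-zeroes b)
    run⇒basisToCoparking b (drop {a = a} sel e∉B run) = endsWith-step body sel
      (subst (λ s → EndsWith s (Vec.zipWith _+_ b a)) (sym (body-∉ e∉B)) (run⇒basisToCoparking b run))
    run⇒basisToCoparking b (keep {e} {i} {a} sel e∈B run) = endsWith-step body sel
      (subst₂ EndsWith (sym (body-∈ e∈B)) (increment-+ b a i) (run⇒basisToCoparking (b [ i ]%= suc) run))

  -- From coparking functions to bases

  module _ (C₀ : Vec (Subset n) g) (a₀ : Vec ℕ g) where
    open CoparkingToBasis C₀ a₀
    open Loop body using (_⟶_; step; EndsWith)

    module _ {e : Fin n} {i : Fin g} {σ : Subset g} {C : Vec (Subset n) g} {z : Vec ℤ g} {S : Subset n} where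

      body-0 : lookup z i ≡ 0ℤ → body e i ⟨ σ , C , (z , S) ⟩ ≡ ⟨ σ - i , C , (z [ i ]%= ℤ.pred , S - e) ⟩
      body-0 zᵢ≡0 rewrite lookup∘updateAt i {ℤ.pred} z | zᵢ≡0 = refl

      body-suc : ∀ {m} → lookup z i ≡ ℤ.+ suc m →
                 body e i ⟨ σ , C , (z , S) ⟩ ≡ ⟨ σ , remove C i e , (z [ i ]%= ℤ.pred , S) ⟩
      body-suc zᵢ≡suc rewrite lookup∘updateAt i {ℤ.pred} z | zᵢ≡suc = refl

    coparkingToBasis-terminates : Terminates
    coparkingToBasis-terminates = terminates body shape start
      where
      shape : DeletesOrContracts body
      shape e i σ C (z , S) with lookup (z [ i ]%= ℤ.pred) i ℤ.<? 0ℤ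
      ... | yes _ = _ , inj₁ refl
      ... | no  _ = _ , inj₂ refl

    -- The coordinates outside σ are never read again.
    AgreeOn : Subset g → Vec ℤ g → Vec ℕ g → Set
    AgreeOn σ z a = ∀ {i} → i ∈ σ → lookup z i ≡ ℤ.+ lookup a i

    agreeOn-delete : ∀ {σ z a i} → AgreeOn σ z a → AgreeOn (σ - i) (z [ i ]%= ℤ.pred) a
    agreeOn-delete {z = z} {i = i} agree {j} j∈ with x∈p-y⁻ j∈
    ... | j∈σ , j≢i = trans (lookup∘updateAt′ j i j≢i z) (agree j∈σ)

    agreeOn-contract : ∀ {σ z a i} → AgreeOn σ z (a [ i ]%= suc) → AgreeOn σ (z [ i ]%= ℤ.pred) a
    agreeOn-contract {z = z} {a} {i} agree {j} j∈σ with j Fin.≟ i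
    ... | yes refl = trans (lookup∘updateAt i z)
      (cong ℤ.pred (trans (agree j∈σ) (cong ℤ.+_ (lookup-inc a i))))
    ... | no  j≢i  = trans (lookup∘updateAt′ j i j≢i z)
      (trans (agree j∈σ) (cong ℤ.+_ (lookup∘updateAt′ j i j≢i a)))

    coparkingToBasis-wellDefined : IsCoparking C₀ a₀ → WellDefined
    coparkingToBasis-wellDefined cop {s} ⟶* ne with reachable-invariant body Q preserved initial ⟶*
      where
      Q : State n g (Vec ℤ g × Subset n) → Set
      -- Dropped indices hold -1 in `z`, so the invariant uses a natural vector that agrees with `z`
      -- on `σ`. Its coparking property keeps the unique union nonempty.
      Q ⟨ σ , C , (z , _) ⟩ = ∃[ a ] CoparkingOn C σ a × AgreeOn σ z a

      initial : Q start
      initial = a₀ , (λ τ _ → cop τ) , λ {i} _ → lookup-map i ℤ.+_ a₀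

      preserved : ∀ {s t} → Q s → s ⟶ t → Q t
      preserved {⟨ σ , C , x@(z , S) ⟩} (a , cop , agree) (step {e} {i} sel@(_ , _ , i∈σ , _))
        with lookup a i in aᵢ≡
      ... | zero rewrite body-0 {e} {i} {σ} {C} {z} {S} (trans (agree i∈σ) (cong ℤ.+_ aᵢ≡)) =
        a , coparkingOn-⊆ C {a = a} (proj₁ ∘ x∈p-y⁻) cop , agreeOn-delete {z = z} {a} agree
      ... | suc m rewrite body-suc {e} {i} {σ} {C} {z} {S} (trans (agree i∈σ) (cong ℤ.+_ aᵢ≡)) =
        a [ i ]%= pred ,
        coparkingOn-contract⁻ C (selects⇒Only {x = x} sel) {a = a [ i ]%= pred}
          (subst (CoparkingOn C σ) (sym (inc∘pred a aᵢ≡)) cop) ,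
        agreeOn-contract {z = z} {a [ i ]%= pred} (subst (AgreeOn σ z) (sym (inc∘pred a aᵢ≡)) agree)
    ... | a , cop′ , _ = select {x = vars s} (coparkingOn⇒Nonempty _ {a = a} cop′ ne)

  -- Correctness of both procedures for a cycle system

  module _ (M : Matroid n) (C₀ : Vec (Subset n) g) (cs : IsCycleSystem M C₀) where
    open Matroid M
    open Minors M C₀ (IsCycleSystem.cycles cs)

    basisToCoparking-wellDefined : ∀ {B} → Indep B → BasisToCoparking.WellDefined C₀ B
    basisToCoparking-wellDefined {B} indB {s} ⟶* ne with reachable-invariant body Q preserved initial ⟶*
      where
      open BasisToCoparking C₀ B
      open Loop body using (_⟶_; step)

      Q : State n g (Vec ℕ g) → Set
      -- Only elements of `B` are contracted, so `K` remains inside `B` and is therefore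
      -- independent.
      Q ⟨ σ , C , _ ⟩ = ∃[ S ] ∃[ K ] IsMinor σ C S K × K ⊆ B

      initial : Q start
      initial = ⊤ , ⊥ , initial-minor M C₀ cs , ⊥⊆

      preserved : ∀ {s t} → Q s → s ⟶ t → Q t
      preserved {⟨ σ , C , a ⟩} (S , K , minor , K⊆B) (step {e} {i} sel) with e ∈? B
      ... | yes e∈B = S , K ∪ ⁅ e ⁆ , contract minor (selects⇒Only {x = a} sel) , p∪⁅x⁆⊆q K⊆B e∈B
      ... | no  _   = S - e , K , delete minor (selects⇒Only {x = a} sel) , K⊆B
    ... | S , K , minor , K⊆B = select {x = vars s} (indep⇒Nonempty minor (hereditary K⊆B indB) ne)

    basis⇒run : ∀ {B} → Indep B → ∀ σ C {S K} → IsMinor σ C S K → K ⊆ B → ∃ (Run B σ C)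
    basis⇒run {B} indB = deletion-contraction-induction
      (λ σ C → ∀ {S K} → IsMinor σ C S K → K ⊆ B → ∃ (Run B σ C)) next
      where
      next : ∀ σ C → (∀ {i} → i ∈ σ → ∀ {S K} → IsMinor (σ - i) C S K → K ⊆ B → ∃ (Run B (σ - i) C)) →
             (∀ {i e} → e ∈ lookup C i →
               ∀ {S K} → IsMinor σ (remove C i e) S K → K ⊆ B → ∃ (Run B σ (remove C i e))) →
             ∀ {S K} → IsMinor σ C S K → K ⊆ B → ∃ (Run B σ C)
      next σ C del con minor K⊆B with nonempty? σ
      ... | no ∅ = _ , stop ∅
      -- The zero vector is a placeholder: the vector of the run is known only after the recursive
      -- call, and the selection does not read it.
      ... | yes ne with select {x = replicate g 0} (indep⇒Nonempty minor (hereditary K⊆B indB) ne)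
      ...   | (e , i) , sel@(_ , _ , i∈σ , e∈i) , _ with e ∈? B
      ...     | yes e∈B =
        let (_ , run) = con e∈i (contract minor (selects⇒Only {x = replicate g 0} sel)) (p∪⁅x⁆⊆q K⊆B e∈B)
        in _ , keep sel e∈B run
      ...     | no  e∉B =
        let (_ , run) = del i∈σ (delete minor (selects⇒Only {x = replicate g 0} sel)) K⊆B
        in _ , drop sel e∉B run

    -- `K⊆B` and `B⊆S` decide membership of the selected element: after a contraction `e` lies in
    -- `K`, hence in `B`; after a deletion it is missing from `S`, hence from `B`.
    record RunFrom (σ : Subset g) (C : Vec (Subset n) g) (S K : Subset n) (a : Vec ℕ g) : Set where
      constructor runFrom
      field
        B     : Subset n
        indep : Indep B
        ∣B∣   : ∣ B ∣ ≡ rank M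
        K⊆B   : K ⊆ B
        B⊆S   : B ⊆ S
        run   : Run B σ C a

    coparking⇒run : ∀ σ C {S K} a → IsMinor σ C S K → CoparkingOn C σ a → ZeroOff σ a → RunFrom σ C S K a
    coparking⇒run = deletion-contraction-induction
      (λ σ C → ∀ {S K} a → IsMinor σ C S K → CoparkingOn C σ a → ZeroOff σ a → RunFrom σ C S K a) next
      where
      next : ∀ σ C →
        (∀ {i} → i ∈ σ → ∀ {S K} a → IsMinor (σ - i) C S K →
          CoparkingOn C (σ - i) a → ZeroOff (σ - i) a → RunFrom (σ - i) C S K a) →
        (∀ {i e} → e ∈ lookup C i → ∀ {S K} a → IsMinor σ (remove C i e) S K →
          CoparkingOn (remove C i e) σ a → ZeroOff σ a → RunFrom σ (remove C i e) S K a) →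
        ∀ {S K} a → IsMinor σ C S K → CoparkingOn C σ a → ZeroOff σ a → RunFrom σ C S K a
      next σ C del con {S} {K} a minor cop off with nonempty? σ
      ... | no ∅ = runFrom S (S-indep minor ∅) (∣S∣≡rank minor ∅) (IsMinor.K⊆S minor) id
        (subst (Run S σ C) (sym (zeroes-unique a λ i → off λ i∈σ → ∅ (i , i∈σ))) (stop ∅))
      ... | yes ne with select {x = a} (coparkingOn⇒Nonempty C {a = a} cop ne)
      ...   | (e , i) , sel@(_ , _ , i∈σ , e∈i) , _ with lookup a i in aᵢ≡
      ...     | zero = runFrom R.B R.indep R.∣B∣ R.K⊆B (proj₁ ∘ x∈p-y⁻ ∘ R.B⊆S)
                         (drop sel (λ e∈B → proj₂ (x∈p-y⁻ (R.B⊆S e∈B)) refl) R.run)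
        where
        off′ : ZeroOff (σ - i) a
        off′ {j} j∉ with j Fin.≟ i
        ... | yes refl = aᵢ≡
        ... | no  j≢i  = off λ j∈σ → j∉ (x∈p∧x≢y⇒x∈p-y j∈σ j≢i)

        module R = RunFrom (del i∈σ a (delete minor (selects⇒Only {x = a} sel))
                     (coparkingOn-⊆ C {a = a} (proj₁ ∘ x∈p-y⁻) cop) off′)
      ...     | suc m = runFrom R.B R.indep R.∣B∣ (R.K⊆B ∘ p⊆p∪q _) R.B⊆S
                         (subst (Run R.B σ C) (inc∘pred a aᵢ≡) (keep sel (R.K⊆B x∈p∪⁅x⁆) R.run))
        where
        off′ : ZeroOff σ (a [ i ]%= pred)
        off′ {j} j∉σ = trans (lookup∘updateAt′ j i (λ { refl → j∉σ i∈σ }) a) (off j∉σ)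

        module R = RunFrom (con e∈i (a [ i ]%= pred) (contract minor (selects⇒Only {x = a} sel))
                     (coparkingOn-contract⁻ C (selects⇒Only {x = a} sel) {a = a [ i ]%= pred}
                       (subst (CoparkingOn C σ) (sym (inc∘pred a aᵢ≡)) cop)) off′)

    -- The set variable of the loop is the `S` of the current minor. It contains the target `B`
    -- throughout, and at the end both have `rank M` elements.
    run⇒coparkingToBasis : ∀ a₀ {B σ C S K a z} → ∣ B ∣ ≡ rank M → IsMinor σ C S K → B ⊆ S →
                           Run B σ C a → AgreeOn C₀ a₀ σ z a →
                           ∃[ z′ ] Loop.EndsWith (CoparkingToBasis.body C₀ a₀) ⟨ σ , C , (z , S) ⟩ (z′ , B)
    run⇒coparkingToBasis a₀ {z = z} ∣B∣ minor B⊆S (stop ∅) agree =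
      z , _ , ε , ∅ , cong (z ,_) (sym (spanning-⊆ minor ∅ B⊆S ∣B∣))
    run⇒coparkingToBasis a₀ {B} {z = z} ∣B∣ minor B⊆S (drop {a = a} sel@(_ , _ , i∈σ , _) e∉B run) agree
      with run⇒coparkingToBasis a₀ ∣B∣ (delete minor (selects⇒Only {x = a} sel)) (p⊆q-x B⊆S e∉B) run
             (agreeOn-delete C₀ a₀ {z = z} {a} agree)
    ... | z′ , ends = z′ , endsWith-step (CoparkingToBasis.body C₀ a₀) sel
      (subst (λ s → Loop.EndsWith (CoparkingToBasis.body C₀ a₀) s (z′ , B))
        (sym (body-0 C₀ a₀ (trans (agree i∈σ) (cong ℤ.+_ (deleted⇒0 run))))) ends)
    run⇒coparkingToBasis a₀ {B} {z = z} ∣B∣ minor B⊆S (keep {i = i} {a} sel@(_ , _ , i∈σ , _) e∈B run) agree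
      with run⇒coparkingToBasis a₀ ∣B∣ (contract minor (selects⇒Only {x = a} sel)) B⊆S run
             (agreeOn-contract C₀ a₀ {z = z} {a} agree)
    ... | z′ , ends = z′ , endsWith-step (CoparkingToBasis.body C₀ a₀) sel
      (subst (λ s → Loop.EndsWith (CoparkingToBasis.body C₀ a₀) s (z′ , B))
        (sym (body-suc C₀ a₀ (trans (agree i∈σ) (cong ℤ.+_ (lookup-inc a i))))) ends)

    -- Where one run drops `i` and the other keeps it, the vectors differ at `i`: zero against
    -- positive. So both follow one path, and its final `S` equals both bases. The equation `a ≡ b`
    -- is a hypothesis of its own because the index `a [ i ]%= suc` of `keep` is no pattern to unify
    -- against.
    run-injective : ∀ {B B′ σ C S K a b} → ∣ B ∣ ≡ rank M → ∣ B′ ∣ ≡ rank M → IsMinor σ C S K →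
                    B ⊆ S → B′ ⊆ S → Run B σ C a → Run B′ σ C b → a ≡ b → B ≡ B′
    run-injective ∣B∣ ∣B′∣ minor B⊆S B′⊆S (stop ∅) (stop _) _ =
      trans (spanning-⊆ minor ∅ B⊆S ∣B∣) (sym (spanning-⊆ minor ∅ B′⊆S ∣B′∣))
    run-injective _ _ _ _ _ (stop ∅) (drop (_ , _ , i∈σ , _) _ _) = contradiction (_ , i∈σ) ∅
    run-injective _ _ _ _ _ (stop ∅) (keep (_ , _ , i∈σ , _) _ _) = contradiction (_ , i∈σ) ∅
    run-injective _ _ _ _ _ (drop (_ , _ , i∈σ , _) _ _) (stop ∅) = contradiction (_ , i∈σ) ∅
    run-injective _ _ _ _ _ (keep (_ , _ , i∈σ , _) _ _) (stop ∅) = contradiction (_ , i∈σ) ∅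
    run-injective ∣B∣ ∣B′∣ minor B⊆S B′⊆S (drop {a = a} sel e∉B run) (drop {a = b} sel′ e∉B′ run′) a≡b
      with selects-unique {x = a} {y = b} sel sel′
    ... | refl = run-injective ∣B∣ ∣B′∣ (delete minor (selects⇒Only {x = a} sel))
                   (p⊆q-x B⊆S e∉B) (p⊆q-x B′⊆S e∉B′) run run′ a≡b
    run-injective ∣B∣ ∣B′∣ minor B⊆S B′⊆S (drop {i = i} {a = a} sel _ run) (keep {a = b} sel′ _ _) a≡b
      with selects-unique {x = a} {y = b} sel sel′
    ... | refl = contradiction
      (trans (sym (deleted⇒0 run)) (trans (cong (λ v → lookup v i) a≡b) (lookup-inc b i))) λ ()
    run-injective ∣B∣ ∣B′∣ minor B⊆S B′⊆S (keep {i = i} {a = a} sel _ _) (drop {a = b} sel′ _ run) a≡b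
      with selects-unique {x = a} {y = b} sel sel′
    ... | refl = contradiction
      (trans (sym (lookup-inc a i)) (trans (cong (λ v → lookup v i) a≡b) (deleted⇒0 run))) λ ()
    run-injective ∣B∣ ∣B′∣ minor B⊆S B′⊆S (keep {i = i} {a = a} sel _ run) (keep {a = b} sel′ _ run′) a≡b
      with selects-unique {x = a} {y = b} sel sel′
    ... | refl = run-injective ∣B∣ ∣B′∣ (contract minor (selects⇒Only {x = a} sel))
                   B⊆S B′⊆S run run′ (increment-injective a b i a≡b)

    private
      toCoparking : ∀ {B} → IsBasis M B → ∃ (Run B ⊤ C₀)
      toCoparking (indB , _) = basis⇒run indB ⊤ C₀ (initial-minor M C₀ cs) ⊥⊆

      fromCoparking : ∀ a → IsCoparking C₀ a → RunFrom ⊤ C₀ ⊤ ⊥ a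
      fromCoparking a cop =
        coparking⇒run ⊤ C₀ a (initial-minor M C₀ cs) (λ τ _ → cop τ) λ i∉⊤ → contradiction ∈⊤ i∉⊤

      fromCoparking-unique : ∀ {a B} (cop : IsCoparking C₀ a) → ∣ B ∣ ≡ rank M → Run B ⊤ C₀ a →
                             RunFrom.B (fromCoparking a cop) ≡ B
      fromCoparking-unique {a} cop ∣B∣ run =
        run-injective (RunFrom.∣B∣ r) ∣B∣ (initial-minor M C₀ cs) ⊆⊤ ⊆⊤ (RunFrom.run r) run refl
        where
        r : RunFrom ⊤ C₀ ⊤ ⊥ a
        r = fromCoparking a cop

    bijection : Inverse (Bases M) (P* C₀)
    bijection = record
      { to        = λ (B , basis) → let (a , run) = toCoparking basis in
                      a , λ τ → run⇒coparkingOn run τ ⊆⊤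
      ; from      = λ (a , cop) → let open RunFrom (fromCoparking a cop) in
                      B , ∣∣≡rank⇒basis M indep ∣B∣
      -- The two proofs of basishood may yield different runs a priori; determinism makes their
      -- vectors equal.
      ; to-cong   = λ { {B , basis} {.B , basis′} refl →
                      run-deterministic (proj₂ (toCoparking basis)) (proj₂ (toCoparking basis′)) }
      ; from-cong = λ { {a , cop} {.a , cop′} refl → let open RunFrom (fromCoparking a cop′) in
                      fromCoparking-unique cop ∣B∣ run }
      ; inverse   =
          (λ { {a , cop} {B , basis} refl →
             run-deterministic (proj₂ (toCoparking basis)) (RunFrom.run (fromCoparking a cop)) }) ,
          (λ { {B , basis} {a , cop} refl →
             fromCoparking-unique cop (basis⇒∣∣≡rank M basis) (proj₂ (toCoparking basis)) })
      }

    bijection-to-outputs : ∀ B → BasisToCoparking.Outputs C₀ (proj₁ B) (proj₁ (Inverse.to bijection B))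
    bijection-to-outputs (B , basis) = let (a , run) = toCoparking basis in
      subst (BasisToCoparking.Outputs C₀ B) (zeroes-+ a) (run⇒basisToCoparking C₀ B (replicate g 0) run)

    bijection-from-outputs : ∀ a → CoparkingToBasis.Outputs C₀ (proj₁ a) (proj₁ (Inverse.from bijection a))
    bijection-from-outputs (a , cop) = let open RunFrom (fromCoparking a cop) in
      run⇒coparkingToBasis a ∣B∣ (initial-minor M C₀ cs) ⊆⊤ run λ {i} _ → lookup-map i ℤ.+_ a

-- Purity

x∈p─q⇒x∉q : ∀ {p q : Subset n} {x} → x ∈ p ─ q → x ∉ q
x∈p─q⇒x∉q {p = _ ∷ _} {true  ∷ _} ()         here
x∈p─q⇒x∉q {p = _ ∷ p} {_     ∷ q} (there x∈) (there x∈q) = x∈p─q⇒x∉q {p = p} {q} x∈ x∈q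

∣p─q∣+∣q∣≡∣p∣ : ∀ (p q : Subset n) → q ⊆ p → ∣ p ─ q ∣ + ∣ q ∣ ≡ ∣ p ∣
∣p─q∣+∣q∣≡∣p∣ []          []          _   = refl
∣p─q∣+∣q∣≡∣p∣ (true  ∷ p) (true  ∷ q) q⊆p = trans (+-suc _ _) (cong suc (∣p─q∣+∣q∣≡∣p∣ p q (drop-∷-⊆ q⊆p)))
∣p─q∣+∣q∣≡∣p∣ (true  ∷ p) (false ∷ q) q⊆p = cong suc (∣p─q∣+∣q∣≡∣p∣ p q (drop-∷-⊆ q⊆p))
∣p─q∣+∣q∣≡∣p∣ (false ∷ p) (true  ∷ q) q⊆p = contradiction (q⊆p here) λ ()
∣p─q∣+∣q∣≡∣p∣ (false ∷ p) (false ∷ q) q⊆p = ∣p─q∣+∣q∣≡∣p∣ p q (drop-∷-⊆ q⊆p)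

sum-replicate-0 : ∀ g → sum (replicate g 0) ≡ 0
sum-replicate-0 zero    = refl
sum-replicate-0 (suc g) = sum-replicate-0 g

sum-set : ∀ (a : Vec ℕ g) i {k} → lookup a i ≡ 0 → sum (a [ i ]%= const k) ≡ k + sum a
sum-set (x ∷ a) zero    refl = refl
sum-set (x ∷ a) (suc i) {k} aᵢ≡0 = trans (cong (x +_) (sum-set a i aᵢ≡0))
  (trans (sym (+-assoc x k (sum a))) (trans (cong (_+ sum a) (+-comm x k)) (+-assoc k x (sum a))))

sum-inc : ∀ (a : Vec ℕ g) i → sum (a [ i ]%= suc) ≡ suc (sum a)
sum-inc (x ∷ a) zero    = refl
sum-inc (x ∷ a) (suc i) = trans (cong (x +_) (sum-inc a i)) (+-suc x (sum a))

lookup⇒≤ᵛ : ∀ {a b : Vec ℕ g} → (∀ i → lookup a i ≤ lookup b i) → a ≤ᵛ b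
lookup⇒≤ᵛ {a = []}    {[]}    _ = []
lookup⇒≤ᵛ {a = _ ∷ _} {_ ∷ _} ≤ = ≤ zero ∷ lookup⇒≤ᵛ (≤ ∘ suc)

-- A relation rather than a computed union, so that `V` minus a private part can be recognised as
-- the union of the remaining sets.
record IsUnion (C : Vec (Subset n) g) (σ : Subset g) (V : Subset n) : Set where
  field
    covered  : ∀ {x} → x ∈ V → ∃[ j ] j ∈ σ × x ∈ lookup C j
    contains : ∀ {j} → j ∈ σ → lookup C j ⊆ V

-- Read off an order in which the indices satisfy the coparking condition one
-- after another and raise each coordinate to the largest value this order
-- allows; the private parts met on the way partition the union V.
raise-coparking : ∀ σ (C : Vec (Subset n) g) {V} a → IsUnion C σ V → CoparkingOn C σ a →
                  ∃[ b ] (∀ {j} → j ∈ σ → lookup a j ≤ lookup b j) × CoparkingOn C σ b × ZeroOff σ b ×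
                         sum b + ∣ σ ∣ ≡ ∣ V ∣
raise-coparking {n} {g} = deletion-contraction-induction P (λ σ C del _ {V} → next σ C del {V})
  where
  P : Subset g → Vec (Subset n) g → Set
  P σ C = ∀ {V} a → IsUnion C σ V → CoparkingOn C σ a →
          ∃[ b ] (∀ {j} → j ∈ σ → lookup a j ≤ lookup b j) × CoparkingOn C σ b × ZeroOff σ b ×
                 sum b + ∣ σ ∣ ≡ ∣ V ∣

  next : ∀ σ C → (∀ {i} → i ∈ σ → P (σ - i) C) → P σ C
  next σ C del {V} a union cop with nonempty? σ
  ... | no ∅ = replicate g 0 , (λ j∈σ → contradiction (_ , j∈σ) ∅) ,
               (λ τ τ⊆σ (i , i∈τ) → contradiction (i , τ⊆σ i∈τ) ∅) ,
               (λ {i} _ → lookup-replicate i 0) , (begin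
      sum (replicate g 0) + ∣ σ ∣ ≡⟨ cong₂ _+_ (sum-replicate-0 g) (Empty⇒∣p∣≡0 ∅) ⟩
      0                           ≡⟨ sym (Empty⇒∣p∣≡0 V-empty) ⟩
      ∣ V ∣                       ∎)
    where
    open ≡-Reasoning
    V-empty : Empty V
    V-empty (x , x∈V) with IsUnion.covered union x∈V
    ... | j , j∈σ , _ = ∅ (j , j∈σ)
  ... | yes ne with cop σ id ne
  ...   | i , i∈σ , aᵢ< with ∣ private-part C σ i ∣ in ∣private∣
  -- `aᵢ<` rules out an empty private part, and `m`, one less than its size, is the largest value it
  -- admits at `i`.
  ...     | suc m with del i∈σ {V = V ─ private-part C σ i} a union′
                          (coparkingOn-⊆ C {a = a} (proj₁ ∘ x∈p-y⁻) cop)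
    where
    open IsUnion union
    union′ : IsUnion C (σ - i) (V ─ private-part C σ i)
    union′ = record { covered = covered′ ; contains = contains′ }
      where
      only-i : ∀ {x} → Empty ((σ - i) ∩ indicesOf C x) → ∀ {k} → k ∈ σ → x ∈ lookup C k → k ≡ i
      only-i ∅ {k} k∈σ x∈k with k Fin.≟ i
      ... | yes k≡i = k≡i
      ... | no  k≢i = contradiction (k , x∈p∩q⁺ (x∈p∧x≢y⇒x∈p-y k∈σ k≢i , ∈indicesOf⁺ C x∈k)) ∅

      covered′ : ∀ {x} → x ∈ V ─ private-part C σ i → ∃[ j ] j ∈ σ - i × x ∈ lookup C j
      covered′ {x} x∈ with nonempty? ((σ - i) ∩ indicesOf C x)
      ... | yes (j , j∈) = let (j∈σ-i , x∈j) = x∈p∩q⁻ (σ - i) _ j∈ in j , j∈σ-i , ∈indicesOf⁻ C x∈j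
      ... | no ∅ with covered (p─q⊆p V (private-part C σ i) x∈)
      ...   | j , j∈σ , x∈j with only-i ∅ j∈σ x∈j
      -- An element that no remaining set covers belongs to `C i` alone. It is then private to `i`
      -- and has already been taken out of `V`.
      ...     | refl = contradiction (∈private⁺ C (i∈σ , x∈j , only-i ∅))
        (x∈p─q⇒x∉q {p = V} {private-part C σ i} x∈)

      contains′ : ∀ {j} → j ∈ σ - i → lookup C j ⊆ V ─ private-part C σ i
      contains′ j∈ x∈j with x∈p-y⁻ j∈
      ... | j∈σ , j≢i = x∈p∧x∉q⇒x∈p─q (contains j∈σ x∈j) λ x∈private →
        j≢i (proj₂ (proj₂ (∈private⁻ C i∈σ x∈private)) j∈σ x∈j)
  ...       | b′ , a≤b′ , cop′ , off′ , sum′ = b , a≤b , cop-b , off-b , sum-b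
    where
    open IsUnion union

    -- `off′` makes `b′` vanish at `i`, so overwriting that coordinate adds exactly `m` to the sum.
    b : Vec ℕ g
    b = b′ [ i ]%= const m

    bᵢ≡m : lookup b i ≡ m
    bᵢ≡m = lookup∘updateAt i b′

    bⱼ≡b′ⱼ : ∀ {j} → j ≢ i → lookup b j ≡ lookup b′ j
    bⱼ≡b′ⱼ {j} j≢i = lookup∘updateAt′ j i j≢i b′

    a≤b : ∀ {j} → j ∈ σ → lookup a j ≤ lookup b j
    a≤b {j} j∈σ with j Fin.≟ i
    ... | yes refl = subst (lookup a i ≤_) (sym bᵢ≡m) (≤-pred aᵢ<)
    ... | no  j≢i  = subst (lookup a j ≤_) (sym (bⱼ≡b′ⱼ j≢i)) (a≤b′ (x∈p∧x≢y⇒x∈p-y j∈σ j≢i))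

    cop-b : CoparkingOn C σ b
    cop-b τ τ⊆σ ne′ with i ∈? τ
    -- The index `i` itself witnesses every `τ` containing it, since its private part in `τ` is at
    -- least as large as the one in `σ`.
    ... | yes i∈τ = i , i∈τ , (begin-strict
      lookup b i             ≡⟨ bᵢ≡m ⟩
      m                      <⟨ ≤-refl ⟩
      suc m                  ≡⟨ sym ∣private∣ ⟩
      ∣ private-part C σ i ∣ ≤⟨ p⊆q⇒∣p∣≤∣q∣ {q = private-part C τ i}
                                 (λ x∈ → ∈private⁺ C (Only-⊆ C τ⊆σ i∈τ (∈private⁻ C i∈σ x∈))) ⟩
      ∣ private-part C τ i ∣ ∎)
      where open ≤-Reasoning
    ... | no i∉τ with cop′ τ (p⊆q-x τ⊆σ i∉τ) ne′
    ...   | k , k∈τ , b′ₖ< = k , k∈τ , subst (_< _) (sym (bⱼ≡b′ⱼ λ { refl → i∉τ k∈τ })) b′ₖ<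

    off-b : ZeroOff σ b
    off-b {j} j∉σ = trans (bⱼ≡b′ⱼ λ { refl → j∉σ i∈σ }) (off′ (j∉σ ∘ proj₁ ∘ x∈p-y⁻))

    -- The private part of `i` has `suc m` elements while `b` gains only `m`; the missing unit per
    -- index is the summand `∣ σ ∣`.
    sum-b : sum b + ∣ σ ∣ ≡ ∣ V ∣
    sum-b = begin
      sum b + ∣ σ ∣                  ≡⟨ cong₂ _+_ (sum-set b′ i (off′ λ i∈ → proj₂ (x∈p-y⁻ i∈) refl))
                                                  (∣p∣≡suc∣p-x∣ i∈σ) ⟩
      m + sum b′ + suc ∣ σ - i ∣     ≡⟨ +-suc (m + sum b′) _ ⟩
      suc (m + sum b′ + ∣ σ - i ∣)   ≡⟨ cong suc (+-assoc m (sum b′) _) ⟩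
      suc m + (sum b′ + ∣ σ - i ∣)   ≡⟨ +-comm (suc m) _ ⟩
      sum b′ + ∣ σ - i ∣ + suc m     ≡⟨ cong₂ _+_ sum′ (sym ∣private∣) ⟩
      ∣ V ─ private-part C σ i ∣ + ∣ private-part C σ i ∣
                                     ≡⟨ ∣p─q∣+∣q∣≡∣p∣ V (private-part C σ i) private⊆V ⟩
      ∣ V ∣                          ∎
      where
      open ≡-Reasoning
      private⊆V : private-part C σ i ⊆ V
      private⊆V x∈ = contains i∈σ (proj₁ (x∈p∩q⁻ (lookup C i) _ x∈))

support : Vec (Subset n) g → Subset n
support C = tabulate λ x → does (nonempty? (indicesOf C x))

support-isUnion : (C : Vec (Subset n) g) → IsUnion C ⊤ (support C)
support-isUnion C = record
  { covered  = λ {x} x∈ →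
      let (j , j∈) = does⇒ (nonempty? (indicesOf C x)) (trans (sym (lookup∘tabulate _ x)) ([]=⇒lookup x∈))
      in j , ∈⊤ , ∈indicesOf⁻ C j∈
  ; contains = λ {j} _ {x} x∈j → lookup⇒[]= x _
      (trans (lookup∘tabulate _ x) (dec-true (nonempty? (indicesOf C x)) (j , ∈indicesOf⁺ C x∈j)))
  }

-- Sums over lists

private
  variable
    X Y : Set

∑ : List X → (X → ℤ) → ℤ
∑ []       f = 0ℤ
∑ (x ∷ xs) f = f x ℤ.+ ∑ xs f

-- The Iverson bracket of `P`, weighted by `z`.
when : {P : Set} → Dec P → ℤ → ℤ
when p? z = if does p? then z else 0ℤ

when-yes : ∀ {P : Set} (p? : Dec P) {z} → P → when p? z ≡ z
when-yes p? p = cong (if_then _ else 0ℤ) (dec-true p? p)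

when-no : ∀ {P : Set} (p? : Dec P) {z} → ¬ P → when p? z ≡ 0ℤ
when-no p? ¬p = cong (if_then _ else 0ℤ) (dec-false p? ¬p)

when-⇔ : ∀ {P Q : Set} (p? : Dec P) (q? : Dec Q) → (P → Q) → (Q → P) → ∀ {z} → when p? z ≡ when q? z
when-⇔ (yes p) q? P⇒Q Q⇒P = sym (when-yes q? (P⇒Q p))
when-⇔ (no ¬p) q? P⇒Q Q⇒P = sym (when-no q? (¬p ∘ Q⇒P))

when-cong : ∀ {P : Set} (p? : Dec P) {y z} → (P → y ≡ z) → when p? y ≡ when p? z
when-cong (yes p) eq = eq p
when-cong (no _)  _  = refl

when-0 : ∀ {P : Set} (p? : Dec P) → when p? 0ℤ ≡ 0ℤ
when-0 (yes _) = refl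
when-0 (no _)  = refl

when-+ : ∀ {P : Set} (p? : Dec P) y z → when p? y ℤ.+ when p? z ≡ when p? (y ℤ.+ z)
when-+ (yes _) y z = refl
when-+ (no _)  y z = refl

when-* : ∀ {P : Set} (p? : Dec P) z → when p? 1ℤ ℤ.* z ≡ when p? z
when-* (yes _) z = ℤ.*-identityˡ z
when-* (no _)  z = refl

∑-cong : ∀ (xs : List X) {f h : X → ℤ} → (∀ x → f x ≡ h x) → ∑ xs f ≡ ∑ xs h
∑-cong []       eq = refl
∑-cong (x ∷ xs) eq = cong₂ ℤ._+_ (eq x) (∑-cong xs eq)

∑-zero : ∀ (xs : List X) {f : X → ℤ} → (∀ x → f x ≡ 0ℤ) → ∑ xs f ≡ 0ℤ
∑-zero []       eq = refl
∑-zero (x ∷ xs) eq = cong₂ ℤ._+_ (eq x) (∑-zero xs eq)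

∑-++ : ∀ (xs ys : List X) {f} → ∑ (xs ++ ys) f ≡ ∑ xs f ℤ.+ ∑ ys f
∑-++ []       ys     = sym (ℤ.+-identityˡ _)
∑-++ (x ∷ xs) ys {f} = trans (cong (λ s → f x ℤ.+ s) (∑-++ xs ys)) (sym (ℤ.+-assoc (f x) _ _))

∑-map : ∀ (h : X → Y) xs {f} → ∑ (map h xs) f ≡ ∑ xs (f ∘ h)
∑-map h []           = refl
∑-map h (x ∷ xs) {f} = cong (λ s → f (h x) ℤ.+ s) (∑-map h xs)

∑-+ : ∀ (xs : List X) (f h : X → ℤ) → ∑ xs (λ x → f x ℤ.+ h x) ≡ ∑ xs f ℤ.+ ∑ xs h
∑-+ []       f h = refl
∑-+ (x ∷ xs) f h = trans (cong (λ s → f x ℤ.+ h x ℤ.+ s) (∑-+ xs f h))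
  (interchange ℤ.+-commutativeSemigroup (f x) (h x) _ _)

∑-* : ∀ (xs : List X) (f : X → ℤ) z → ∑ xs f ℤ.* z ≡ ∑ xs (λ x → f x ℤ.* z)
∑-* []       f z = refl
∑-* (x ∷ xs) f z = trans (ℤ.*-distribʳ-+ z (f x) _) (cong (λ s → f x ℤ.* z ℤ.+ s) (∑-* xs f z))

∑-swap : ∀ (xs : List X) (ys : List Y) (f : X → Y → ℤ) →
         ∑ xs (λ x → ∑ ys (f x)) ≡ ∑ ys (λ y → ∑ xs (λ x → f x y))
∑-swap []       ys f = sym (∑-zero ys λ _ → refl)
∑-swap (x ∷ xs) ys f = trans (cong (λ s → ∑ ys (f x) ℤ.+ s) (∑-swap xs ys f)) (sym (∑-+ ys (f x) _))

∑-filter : ∀ {P : X → Set} (P? : Decidable P) xs {f} → ∑ (filter P? xs) f ≡ ∑ xs (λ x → when (P? x) (f x))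
∑-filter P? [] = refl
∑-filter P? (x ∷ xs) {f} with P? x
... | yes _ = cong (λ s → f x ℤ.+ s) (∑-filter P? xs)
... | no  _ = trans (∑-filter P? xs) (sym (ℤ.+-identityˡ _))

length-filter : ∀ {P : X → Set} (P? : Decidable P) xs →
                ℤ.+ length (filter P? xs) ≡ ∑ xs (λ x → when (P? x) 1ℤ)
length-filter P? xs = trans (length-∑ (filter P? xs)) (∑-filter P? xs)
  where
  length-∑ : ∀ xs → ℤ.+ length xs ≡ ∑ xs (λ _ → 1ℤ)
  length-∑ []       = refl
  length-∑ (x ∷ xs) = cong (λ s → 1ℤ ℤ.+ s) (length-∑ xs)

∑-upTo-when : ∀ {k m} → k < m → (w : ℕ → ℤ) → ∑ (upTo m) (λ i → when (k ℕ.≟ i) (w i)) ≡ w k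
∑-upTo-when {k} {suc m} k<m w = begin
  when (k ℕ.≟ 0) (w 0) ℤ.+ ∑ (applyUpTo suc m) f
    ≡⟨ cong (λ xs → f 0 ℤ.+ ∑ xs f) (sym (map-applyUpTo id suc m)) ⟩
  when (k ℕ.≟ 0) (w 0) ℤ.+ ∑ (map suc (upTo m)) f   ≡⟨ cong (λ s → f 0 ℤ.+ s) (∑-map suc (upTo m)) ⟩
  when (k ℕ.≟ 0) (w 0) ℤ.+ ∑ (upTo m) (f ∘ suc)     ≡⟨ split k k<m ⟩
  w k                                               ∎
  where
  open ≡-Reasoning
  f : ℕ → ℤ
  f i = when (k ℕ.≟ i) (w i)

  split : ∀ k → k < suc m →
          when (k ℕ.≟ 0) (w 0) ℤ.+ ∑ (upTo m) (λ i → when (k ℕ.≟ suc i) (w (suc i))) ≡ w k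
  split zero    _         = trans (cong (λ s → w 0 ℤ.+ s) (∑-zero (upTo m) λ _ → refl)) (ℤ.+-identityʳ (w 0))
  split (suc k) (s≤s k<m) = trans (ℤ.+-identityˡ _) (∑-upTo-when k<m (w ∘ suc))

-- Coefficients

entry-⊞ : ∀ p q j → entry (p ⊞ q) j ≡ entry p j ℤ.+ entry q j
entry-⊞ []      q       j       = sym (ℤ.+-identityˡ _)
entry-⊞ (a ∷ p) []      j       = sym (ℤ.+-identityʳ _)
entry-⊞ (a ∷ p) (b ∷ q) zero    = refl
entry-⊞ (a ∷ p) (b ∷ q) (suc j) = entry-⊞ p q j

entry-map : ∀ c q j → entry (map (c ℤ.*_) q) j ≡ c ℤ.* entry q j
entry-map c []      j       = sym (ℤ.*-zeroʳ c)
entry-map c (a ∷ q) zero    = refl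
entry-map c (a ∷ q) (suc j) = entry-map c q j

entry-scale : ∀ c q j → entry ((c ∷ []) ⊠ q) j ≡ c ℤ.* entry q j
entry-scale c q j = trans (entry-⊞ (map (c ℤ.*_) q) (0ℤ ∷ []) j)
  (trans (cong₂ ℤ._+_ (entry-map c q j) (entry-0 j)) (ℤ.+-identityʳ _))
  where
  entry-0 : ∀ j → entry (0ℤ ∷ []) j ≡ 0ℤ
  entry-0 zero    = refl
  entry-0 (suc j) = refl

entry-foldr : ∀ ps j → entry (foldr _⊞_ [] ps) j ≡ ∑ ps (λ p → entry p j)
entry-foldr []       j = refl
entry-foldr (p ∷ ps) j = trans (entry-⊞ p (foldr _⊞_ [] ps) j)
  (cong (λ s → entry p j ℤ.+ s) (entry-foldr ps j))

entry-applyUpTo-< : ∀ f {m k} → k < m → entry (applyUpTo f m) k ≡ f k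
entry-applyUpTo-< f {suc m} {zero}  _         = refl
entry-applyUpTo-< f {suc m} {suc k} (s≤s k<m) = entry-applyUpTo-< (f ∘ suc) k<m

entry-applyUpTo-≥ : ∀ f {m k} → m ≤ k → entry (applyUpTo f m) k ≡ 0ℤ
entry-applyUpTo-≥ f {zero}          _         = refl
entry-applyUpTo-≥ f {suc m} {suc k} (s≤s m≤k) = entry-applyUpTo-≥ (f ∘ suc) m≤k

coeff : ℕ → ℕ → ℤ
coeff m j = entry (t-1 ^ᵖ m) j

entry-t-1⊠ : ∀ p j → entry (t-1 ⊠ p) j ≡ ℤ.- entry p j ℤ.+ entry (0ℤ ∷ p) j
entry-t-1⊠ p j = trans (entry-⊞ (map (ℤ.-1ℤ ℤ.*_) p) (0ℤ ∷ (1ℤ ∷ []) ⊠ p) j)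
  (cong₂ ℤ._+_ (trans (entry-map ℤ.-1ℤ p j) (ℤ.-1*i≡-i (entry p j))) (shifted j))
  where
  shifted : ∀ j → entry (0ℤ ∷ (1ℤ ∷ []) ⊠ p) j ≡ entry (0ℤ ∷ p) j
  shifted zero    = refl
  shifted (suc j) = trans (entry-scale 1ℤ p j) (ℤ.*-identityˡ _)

-- Coefficients of (t - 1)^(m+1) + (t - 1)^m = t (t - 1)^m, where prepending `0ℤ` is multiplication
-- by t.
coeff-pascal : ∀ m j → coeff (suc m) j ℤ.+ coeff m j ≡ entry (0ℤ ∷ t-1 ^ᵖ m) j
coeff-pascal m j = begin
  coeff (suc m) j ℤ.+ c           ≡⟨ cong (ℤ._+ c) (entry-t-1⊠ (t-1 ^ᵖ m) j) ⟩
  ℤ.- c ℤ.+ s ℤ.+ c               ≡⟨ cong (ℤ._+ c) (ℤ.+-comm (ℤ.- c) s) ⟩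
  s ℤ.+ ℤ.- c ℤ.+ c               ≡⟨ ℤ.+-assoc s (ℤ.- c) c ⟩
  s ℤ.+ (ℤ.- c ℤ.+ c)             ≡⟨ cong (λ z → s ℤ.+ z) (ℤ.+-inverseˡ c) ⟩
  s ℤ.+ 0ℤ                        ≡⟨ ℤ.+-identityʳ s ⟩
  s                               ∎
  where
  open ≡-Reasoning
  c s : ℤ
  c = coeff m j
  s = entry (0ℤ ∷ t-1 ^ᵖ m) j

_⊆_⊆?_ : (K I S : Subset n) → Dec (K ⊆ I × I ⊆ S)
K ⊆ I ⊆? S = (K ⊆? I) ×-dec (I ⊆? S)

-- Each element of `S` outside `K` is left out or put in, contributing the factor (t - 1) + 1 = t.
-- The total is t^(|S| - |K|), and the bracket is its coefficient at `j`, written additively to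
-- avoid truncated subtraction.
∑-interval : (K S : Subset n) → K ⊆ S → ∀ j →
             ∑ (allSubsets n) (λ I → when (K ⊆ I ⊆? S) (coeff (∣ S ∣ ∸ ∣ I ∣) j)) ≡
             when (∣ K ∣ + j ℕ.≟ ∣ S ∣) 1ℤ
∑-interval [] [] _ zero    = refl
∑-interval [] [] _ (suc j) = refl
∑-interval {suc n} (k ∷ K) (s ∷ S) K⊆S j = begin
  ∑ (map (false ∷_) as ++ map (true ∷_) as) f       ≡⟨ ∑-++ (map (false ∷_) as) (map (true ∷_) as) ⟩
  ∑ (map (false ∷_) as) f ℤ.+ ∑ (map (true ∷_) as) f
    ≡⟨ cong₂ ℤ._+_ (∑-map (false ∷_) as) (∑-map (true ∷_) as) ⟩
  ∑ as (f ∘ (false ∷_)) ℤ.+ ∑ as (f ∘ (true ∷_))    ≡⟨ heads k s K⊆S j ⟩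
  when (∣ k ∷ K ∣ + j ℕ.≟ ∣ s ∷ S ∣) 1ℤ             ∎
  where
  open ≡-Reasoning
  as : List (Subset n)
  as = allSubsets n

  f : Subset (suc n) → ℤ
  f I = when ((k ∷ K) ⊆ I ⊆? (s ∷ S)) (coeff (∣ s ∷ S ∣ ∸ ∣ I ∣) j)

  heads : ∀ k s → k ∷ K ⊆ s ∷ S → ∀ j →
          ∑ as (λ I → when ((k ∷ K) ⊆ false ∷ I ⊆? (s ∷ S)) (coeff (∣ s ∷ S ∣ ∸ ∣ false ∷ I ∣) j)) ℤ.+
          ∑ as (λ I → when ((k ∷ K) ⊆ true ∷ I ⊆? (s ∷ S)) (coeff (∣ s ∷ S ∣ ∸ ∣ true ∷ I ∣) j)) ≡
          when (∣ k ∷ K ∣ + j ℕ.≟ ∣ s ∷ S ∣) 1ℤ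
  heads true false K⊆S j = contradiction (K⊆S here) λ ()
  heads true true K⊆S j = trans (cong₂ ℤ._+_
      (∑-zero as λ _ → refl)
      (trans (∑-cong as λ I → when-⇔ ((true ∷ K) ⊆ true ∷ I ⊆? (true ∷ S)) (K ⊆ I ⊆? S)
        (λ (K⊆I , I⊆S) → drop-∷-⊆ K⊆I , drop-∷-⊆ I⊆S) λ (K⊆I , I⊆S) → s⊆s K⊆I , s⊆s I⊆S)
        (∑-interval K S (drop-∷-⊆ K⊆S) j)))
    (ℤ.+-identityˡ _)
  heads false false K⊆S j = trans (cong₂ ℤ._+_
      (trans (∑-cong as λ I → when-⇔ ((false ∷ K) ⊆ false ∷ I ⊆? (false ∷ S)) (K ⊆ I ⊆? S)
        (λ (K⊆I , I⊆S) → drop-∷-⊆ K⊆I , drop-∷-⊆ I⊆S) λ (K⊆I , I⊆S) → s⊆s K⊆I , s⊆s I⊆S)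
        (∑-interval K S (drop-∷-⊆ K⊆S) j))
      (∑-zero as λ I → when-no ((false ∷ K) ⊆ true ∷ I ⊆? (false ∷ S))
        λ (_ , I⊆S) → contradiction (I⊆S here) λ ()))
    (ℤ.+-identityʳ _)
  heads false true K⊆S j = begin
    ∑ as (λ I → when ((false ∷ K) ⊆ false ∷ I ⊆? (true ∷ S)) (coeff (suc ∣ S ∣ ∸ ∣ I ∣) j)) ℤ.+
    ∑ as (λ I → when ((false ∷ K) ⊆ true ∷ I ⊆? (true ∷ S)) (coeff (∣ S ∣ ∸ ∣ I ∣) j))
      ≡⟨ cong₂ ℤ._+_
        (∑-cong as λ I → trans
          (when-⇔ ((false ∷ K) ⊆ false ∷ I ⊆? (true ∷ S)) (K ⊆ I ⊆? S)
            (λ (K⊆I , I⊆S) → drop-∷-⊆ K⊆I , drop-∷-⊆ I⊆S) λ (K⊆I , I⊆S) → out⊆ K⊆I , out⊆ I⊆S)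
          -- Moving `suc` out of the truncated difference requires |I| ≤ |S|; `when-cong` asks for
          -- the equality only where `I ⊆ S` holds.
          (when-cong (K ⊆ I ⊆? S) λ (_ , I⊆S) → cong (λ m → coeff m j) (+-∸-assoc 1 (p⊆q⇒∣p∣≤∣q∣ I⊆S))))
        (∑-cong as λ I →
          when-⇔ ((false ∷ K) ⊆ true ∷ I ⊆? (true ∷ S)) (K ⊆ I ⊆? S)
            (λ (K⊆I , I⊆S) → drop-∷-⊆ K⊆I , drop-∷-⊆ I⊆S) λ (K⊆I , I⊆S) → out⊆ K⊆I , s⊆s I⊆S) ⟩
    ∑ as (λ I → when (K ⊆ I ⊆? S) (coeff (suc (∣ S ∣ ∸ ∣ I ∣)) j)) ℤ.+
    ∑ as (λ I → when (K ⊆ I ⊆? S) (coeff (∣ S ∣ ∸ ∣ I ∣) j))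
      ≡⟨ sym (∑-+ as _ _) ⟩
    ∑ as (λ I → when (K ⊆ I ⊆? S) (coeff (suc (∣ S ∣ ∸ ∣ I ∣)) j) ℤ.+
                 when (K ⊆ I ⊆? S) (coeff (∣ S ∣ ∸ ∣ I ∣) j))
      ≡⟨ ∑-cong as (λ I → trans (when-+ (K ⊆ I ⊆? S) (coeff (suc (∣ S ∣ ∸ ∣ I ∣)) j) _)
           (cong (when (K ⊆ I ⊆? S)) (coeff-pascal (∣ S ∣ ∸ ∣ I ∣) j))) ⟩
    ∑ as (λ I → when (K ⊆ I ⊆? S) (entry (0ℤ ∷ t-1 ^ᵖ (∣ S ∣ ∸ ∣ I ∣)) j))
      ≡⟨ shift j ⟩
    when (∣ K ∣ + j ℕ.≟ suc ∣ S ∣) 1ℤ ∎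
    where
    shift : ∀ j → ∑ as (λ I → when (K ⊆ I ⊆? S) (entry (0ℤ ∷ t-1 ^ᵖ (∣ S ∣ ∸ ∣ I ∣)) j)) ≡
                  when (∣ K ∣ + j ℕ.≟ suc ∣ S ∣) 1ℤ
    shift zero = trans (∑-zero as λ I → when-0 (K ⊆ I ⊆? S))
      (sym (when-no (∣ K ∣ + 0 ℕ.≟ suc ∣ S ∣) λ eq →
        <-irrefl (trans (sym (+-identityʳ ∣ K ∣)) eq) (s≤s (p⊆q⇒∣p∣≤∣q∣ (drop-∷-⊆ K⊆S)))))
    shift (suc j) = trans (∑-interval K S (drop-∷-⊆ K⊆S) j)
      (when-⇔ (∣ K ∣ + j ℕ.≟ ∣ S ∣) (∣ K ∣ + suc j ℕ.≟ suc ∣ S ∣)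
        (λ eq → trans (+-suc ∣ K ∣ j) (cong suc eq)) λ eq → suc-injective (trans (sym (+-suc ∣ K ∣ j)) eq))

-- The h-vector

module _ (M : Matroid n) where
  open Matroid M

  -- Exchanging the sums over sizes and over independent sets leaves one term per independent set,
  -- since each size is at most the rank. Indexing by all subsets prepares the splitting by a
  -- selected element.
  entry-hPoly : ∀ j → entry (hPoly M) j ≡
                ∑ (allSubsets n) (λ I → when (indep? I) (coeff (rank M ∸ ∣ I ∣) j))
  entry-hPoly j = begin
    entry (hPoly M) j
      ≡⟨ entry-foldr (applyUpTo term (suc (rank M))) j ⟩
    ∑ (applyUpTo term (suc (rank M))) (λ p → entry p j)
      ≡⟨ cong (λ ps → ∑ ps (λ p → entry p j)) (sym (map-applyUpTo id term (suc (rank M)))) ⟩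
    ∑ (map term is) (λ p → entry p j)
      ≡⟨ ∑-map term is {λ p → entry p j} ⟩
    ∑ is (λ i → entry (term i) j)
      ≡⟨ ∑-cong is (λ i → trans (entry-scale (ℤ.+ #indep M i) (t-1 ^ᵖ (rank M ∸ i)) j)
           (cong (ℤ._* w i) (length-filter (λ I → ∣ I ∣ ℕ.≟ i) (independentSets M)))) ⟩
    ∑ is (λ i → ∑ (independentSets M) (λ I → when (∣ I ∣ ℕ.≟ i) 1ℤ) ℤ.* w i)
      ≡⟨ ∑-cong is (λ i → trans (∑-* (independentSets M) _ (w i))
           (∑-cong (independentSets M) λ I → when-* (∣ I ∣ ℕ.≟ i) (w i))) ⟩
    ∑ is (λ i → ∑ (independentSets M) (λ I → when (∣ I ∣ ℕ.≟ i) (w i)))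
      ≡⟨ ∑-swap is (independentSets M) _ ⟩
    ∑ (independentSets M) (λ I → ∑ is (λ i → when (∣ I ∣ ℕ.≟ i) (w i)))
      ≡⟨ ∑-filter indep? (allSubsets n) ⟩
    ∑ (allSubsets n) (λ I → when (indep? I) (∑ is (λ i → when (∣ I ∣ ℕ.≟ i) (w i))))
      ≡⟨ ∑-cong (allSubsets n) (λ I → when-cong (indep? I) λ ind →
           ∑-upTo-when (s≤s (∣indep∣≤rank M ind)) w) ⟩
    ∑ (allSubsets n) (λ I → when (indep? I) (w ∣ I ∣)) ∎
    where
    open ≡-Reasoning
    is : List ℕ
    is = upTo (suc (rank M))

    w : ℕ → ℤ
    w i = coeff (rank M ∸ i) j

    term : ℕ → Poly
    term i = (ℤ.+ #indep M i ∷ []) ⊠ t-1 ^ᵖ (rank M ∸ i)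

  IndepBetween? : (K S I : Subset n) → Dec ((K ⊆ I × I ⊆ S) × Indep I)
  IndepBetween? K S I = (K ⊆ I ⊆? S) ×-dec indep? I

  -- The share of the independent sets between `K` and `S` in the coefficient of t^j of `hPoly`. The
  -- exponent refers to the rank of `M` throughout, so that shares of different minors add up.
  hSum : (K S : Subset n) → ℕ → ℤ
  hSum K S j = ∑ (allSubsets n) λ I → when (IndepBetween? K S I) (coeff (rank M ∸ ∣ I ∣) j)

  hSum-dependent : ∀ {K S} → Dependent K → ∀ j → hSum K S j ≡ 0ℤ
  hSum-dependent {K} {S} dep j = ∑-zero (allSubsets n) λ I →
    when-no (IndepBetween? K S I) λ ((K⊆I , _) , ind) → dep (hereditary K⊆I ind)

  hSum-basis : ∀ {K S} → K ⊆ S → Indep S → ∣ S ∣ ≡ rank M → ∀ j → hSum K S j ≡ when (∣ K ∣ + j ℕ.≟ rank M) 1ℤ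
  hSum-basis {K} {S} K⊆S ind ∣S∣ j rewrite sym ∣S∣ = trans
    (∑-cong (allSubsets n) λ I → when-⇔ (IndepBetween? K S I) (K ⊆ I ⊆? S)
      proj₁ λ (K⊆I , I⊆S) → (K⊆I , I⊆S) , hereditary I⊆S ind)
    (∑-interval K S K⊆S j)

  hSum-split : ∀ {K S e} → e ∈ S → e ∉ K → ∀ j → hSum K S j ≡ hSum K (S - e) j ℤ.+ hSum (K ∪ ⁅ e ⁆) S j
  hSum-split {K} {S} {e} e∈S e∉K j = trans
    (∑-cong (allSubsets n) λ I → split I (coeff (rank M ∸ ∣ I ∣) j))
    (∑-+ (allSubsets n) _ _)
    where
    split : ∀ I z → when (IndepBetween? K S I) z ≡
                      when (IndepBetween? K (S - e) I) z ℤ.+ when (IndepBetween? (K ∪ ⁅ e ⁆) S I) z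
    split I z with e ∈? I
    ... | yes e∈I = trans
      (when-⇔ (IndepBetween? K S I) (IndepBetween? (K ∪ ⁅ e ⁆) S I)
        (λ ((K⊆I , I⊆S) , ind) → (p∪⁅x⁆⊆q K⊆I e∈I , I⊆S) , ind)
        (λ ((K⊆I , I⊆S) , ind) → (K⊆I ∘ p⊆p∪q ⁅ e ⁆ , I⊆S) , ind))
      (sym (trans (cong (ℤ._+ when (IndepBetween? (K ∪ ⁅ e ⁆) S I) z)
                    (when-no (IndepBetween? K (S - e) I) λ ((_ , I⊆S-e) , _) →
                      proj₂ (x∈p-y⁻ (I⊆S-e e∈I)) refl))
                  (ℤ.+-identityˡ _)))
    ... | no e∉I = trans
      (when-⇔ (IndepBetween? K S I) (IndepBetween? K (S - e) I)
        (λ ((K⊆I , I⊆S) , ind) → (K⊆I , p⊆q-x I⊆S e∉I) , ind)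
        (λ ((K⊆I , I⊆S) , ind) → (K⊆I , proj₁ ∘ x∈p-y⁻ ∘ I⊆S) , ind))
      (sym (trans (cong (λ s → when (IndepBetween? K (S - e) I) z ℤ.+ s)
                    (when-no (IndepBetween? (K ∪ ⁅ e ⁆) S I) λ ((K⊆I , _) , _) → e∉I (K⊆I x∈p∪⁅x⁆)))
                  (ℤ.+-identityʳ _)))

-- Enumeration of coparking functions and the pure O-sequence

module _ (M : Matroid n) (C₀ : Vec (Subset n) g) (cs : IsCycleSystem M C₀) where
  open Matroid M
  open Minors M C₀ (IsCycleSystem.cycles cs)

  -- `bounded` covers degrees above the rank: there `hVector` has ended, and `hSum≡`, with `j` a
  -- natural number, gives no information.
  record Enumeration (σ : Subset g) (C : Vec (Subset n) g) (S K : Subset n) : Set where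
    field
      list     : List (Vec ℕ g)
      unique   : Unique list
      sound    : ∀ {a} → a List.∈ list → CoparkingOn C σ a × ZeroOff σ a
      complete : ∀ {a} → CoparkingOn C σ a → ZeroOff σ a → a List.∈ list
      bounded  : ∀ {a} → a List.∈ list → ∣ K ∣ + sum a ≤ rank M
      -- The coefficients of t ^ j in Σ_I (t - 1) ^ (r - |I|) = Σ_a t ^ (r - |K| - Σᵢ aᵢ).
      hSum≡    : ∀ j → hSum M K S j ≡ ∑ list (λ a → when (∣ K ∣ + sum a + j ℕ.≟ rank M) 1ℤ)

  enumerate : ∀ σ C {S K} → IsMinor σ C S K → Enumeration σ C S K
  enumerate = deletion-contraction-induction (λ σ C → ∀ {S K} → IsMinor σ C S K → Enumeration σ C S K) next
    where
    next : ∀ σ C → (∀ {i} → i ∈ σ → ∀ {S K} → IsMinor (σ - i) C S K → Enumeration (σ - i) C S K) →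
           (∀ {i e} → e ∈ lookup C i →
             ∀ {S K} → IsMinor σ (remove C i e) S K → Enumeration σ (remove C i e) S K) →
           ∀ {S K} → IsMinor σ C S K → Enumeration σ C S K
    next σ C del con {S} {K} minor with nonempty? σ | indep? K
    ... | no ∅ | _ = record
      { list     = replicate g 0 ∷ []
      ; unique   = [] ∷ []
      ; sound    = λ { (here refl) → (λ τ τ⊆σ (i , i∈τ) → contradiction (i , τ⊆σ i∈τ) ∅) ,
                                  λ {i} _ → lookup-replicate i 0 }
      ; complete = λ {a} _ off → here (zeroes-unique a λ i → off λ i∈σ → ∅ (i , i∈σ))
      ; bounded  = λ { (here refl) → subst₂ _≤_ (sym ∣K∣+0) (∣S∣≡rank minor ∅) (p⊆q⇒∣p∣≤∣q∣ K⊆S) }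
      ; hSum≡    = λ j → trans (hSum-basis M K⊆S (S-indep minor ∅) (∣S∣≡rank minor ∅) j)
          (sym (trans (ℤ.+-identityʳ _) (cong (λ k → when (k + j ℕ.≟ rank M) 1ℤ) ∣K∣+0)))
      }
      where
      open IsMinor minor
      ∣K∣+0 : ∣ K ∣ + sum (replicate g 0) ≡ ∣ K ∣
      ∣K∣+0 = trans (cong (∣ K ∣ +_) (sum-replicate-0 g)) (+-identityʳ ∣ K ∣)
    -- Both counts vanish: no independent set contains `K`, and a coparking function would make `K`
    -- independent.
    ... | yes _ | no dep = record
      { list     = []
      ; unique   = []
      ; sound    = λ ()
      ; complete = λ {a} cop _ → contradiction (coparkingOn⇒indep σ C a minor cop) dep
      ; bounded  = λ ()
      ; hSum≡    = hSum-dependent M dep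
      }
    ... | yes ne | yes indK with uniqueUnion⁻ C (proj₂ (indep⇒Nonempty minor indK ne))
    ...   | i , sel@(i∈σ , e∈i , _) = record
      { list     = D.list ++ map inc E.list
      ; unique   = Unique.++⁺ D.unique (Unique.map⁺ (λ {a} {b} → increment-injective a b i) E.unique) disjoint
      ; sound    = sound
      ; complete = complete
      ; bounded  = bounded
      ; hSum≡    = hSum≡
      }
      where
      module D = Enumeration (del i∈σ (delete minor sel))
      module E = Enumeration (con e∈i (contract minor sel))

      inc : Vec ℕ g → Vec ℕ g
      inc a = a [ i ]%= suc

      D⇒0 : ∀ {a} → a List.∈ D.list → lookup a i ≡ 0
      D⇒0 a∈ = proj₂ (D.sound a∈) λ i∈ → proj₂ (x∈p-y⁻ i∈) refl

      disjoint : ∀ {a} → ¬ (a List.∈ D.list × a List.∈ map inc E.list)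
      disjoint (a∈D , a∈E) with ∈-map⁻ inc a∈E
      ... | b , _ , refl = contradiction (trans (sym (lookup-inc b i)) (D⇒0 a∈D)) λ ()

      sound : ∀ {a} → a List.∈ D.list ++ map inc E.list → CoparkingOn C σ a × ZeroOff σ a
      sound {a} a∈ with ∈-++⁻ D.list a∈
      ... | inj₁ a∈D = let (cop , off) = D.sound a∈D in
        coparkingOn-delete C sel {a = a} (D⇒0 a∈D) cop , λ j∉σ → off (j∉σ ∘ proj₁ ∘ x∈p-y⁻)
      ... | inj₂ a∈E with ∈-map⁻ inc a∈E
      ...   | b , b∈E , refl = let (cop , off) = E.sound b∈E in
        coparkingOn-contract⁺ C sel {a = b} cop ,
        λ {j} j∉σ → trans (lookup∘updateAt′ j i (λ { refl → j∉σ i∈σ }) b) (off j∉σ)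

      complete : ∀ {a} → CoparkingOn C σ a → ZeroOff σ a → a List.∈ D.list ++ map inc E.list
      complete {a} cop off with lookup a i in aᵢ≡
      ... | zero = ∈-++⁺ˡ (D.complete (coparkingOn-⊆ C {a = a} (proj₁ ∘ x∈p-y⁻) cop) off′)
        where
        off′ : ZeroOff (σ - i) a
        off′ {j} j∉ with j Fin.≟ i
        ... | yes refl = aᵢ≡
        ... | no  j≢i  = off λ j∈σ → j∉ (x∈p∧x≢y⇒x∈p-y j∈σ j≢i)
      ... | suc _ = ∈-++⁺ʳ D.list (subst (List._∈ map inc E.list) (inc∘pred a aᵢ≡) (∈-map⁺ inc (E.complete
          (coparkingOn-contract⁻ C sel {a = a [ i ]%= pred}
            (subst (CoparkingOn C σ) (sym (inc∘pred a aᵢ≡)) cop))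
          λ {j} j∉σ → trans (lookup∘updateAt′ j i (λ { refl → j∉σ i∈σ }) a) (off j∉σ))))

      -- Passing back from the contraction, `K` loses `e` and `a_i` gains one, so |K| + `sum a` is
      -- the same in parent and child.
      degree : ∀ a → ∣ K ∪ ⁅ _ ⁆ ∣ + sum a ≡ ∣ K ∣ + sum (inc a)
      degree a = begin
        ∣ K ∪ ⁅ _ ⁆ ∣ + sum a  ≡⟨ cong (_+ sum a) (∣p∪⁅x⁆∣≡suc∣p∣ (e∉K minor sel)) ⟩
        suc ∣ K ∣ + sum a      ≡⟨ sym (+-suc ∣ K ∣ (sum a)) ⟩
        ∣ K ∣ + suc (sum a)    ≡⟨ cong (∣ K ∣ +_) (sym (sum-inc a i)) ⟩
        ∣ K ∣ + sum (inc a)    ∎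
        where open ≡-Reasoning

      bounded : ∀ {a} → a List.∈ D.list ++ map inc E.list → ∣ K ∣ + sum a ≤ rank M
      bounded a∈ with ∈-++⁻ D.list a∈
      ... | inj₁ a∈D = D.bounded a∈D
      ... | inj₂ a∈E with ∈-map⁻ inc a∈E
      ...   | b , b∈E , refl = subst (_≤ rank M) (degree b) (E.bounded b∈E)

      hSum≡ : ∀ j → hSum M K S j ≡ ∑ (D.list ++ map inc E.list) (λ a → when (∣ K ∣ + sum a + j ℕ.≟ rank M) 1ℤ)
      hSum≡ j = begin
        hSum M K S j
          ≡⟨ hSum-split M (e∈S minor sel) (e∉K minor sel) j ⟩
        hSum M K (S - _) j ℤ.+ hSum M (K ∪ ⁅ _ ⁆) S j
          ≡⟨ cong₂ ℤ._+_ (D.hSum≡ j) (E.hSum≡ j) ⟩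
        ∑ D.list f ℤ.+ ∑ E.list (λ a → when (∣ K ∪ ⁅ _ ⁆ ∣ + sum a + j ℕ.≟ rank M) 1ℤ)
          ≡⟨ cong (λ s → ∑ D.list f ℤ.+ s)
               (∑-cong E.list λ a → cong (λ k → when (k + j ℕ.≟ rank M) 1ℤ) (degree a)) ⟩
        ∑ D.list f ℤ.+ ∑ E.list (f ∘ inc)
          ≡⟨ cong (λ s → ∑ D.list f ℤ.+ s) (sym (∑-map inc E.list)) ⟩
        ∑ D.list f ℤ.+ ∑ (map inc E.list) f
          ≡⟨ sym (∑-++ D.list (map inc E.list)) ⟩
        ∑ (D.list ++ map inc E.list) f ∎
        where
        open ≡-Reasoning
        f : Vec ℕ g → ℤ
        f a = when (∣ K ∣ + sum a + j ℕ.≟ rank M) 1ℤ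

  private
    coparkings : Enumeration ⊤ C₀ ⊤ ⊥
    coparkings = enumerate ⊤ C₀ (initial-minor M C₀ cs)

    module E = Enumeration coparkings

    zeroOff⊤ : ∀ {a : Vec ℕ g} → ZeroOff ⊤ a
    zeroOff⊤ i∉⊤ = contradiction ∈⊤ i∉⊤

  coparkings-isPureOrderIdeal : IsPureOrderIdeal E.list
  coparkings-isPureOrderIdeal = record
    { unique     = E.unique
    ; nonempty   = nonempty
    ; downClosed = λ {a} {b} a∈ b≤a → E.complete
        (coparkingOn-≤ C₀ {a = a} {b} (Pointwise.lookup b≤a) (proj₁ (E.sound a∈))) (zeroOff⊤ {b})
    ; pure       = λ {a} {b} max-a max-b → +-cancelʳ-≡ ∣ ⊤ {g} ∣ (sum a) (sum b)
        (trans (degree a max-a) (sym (degree b max-b)))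
    }
    where
    zeroes-coparking : CoparkingOn C₀ ⊤ (replicate g 0)
    zeroes-coparking τ _ ne with nonempty? (uniqueUnion C₀ τ)
    -- The empty set is independent, so a dependent unique union has an element, and the owner of
    -- that element exceeds 0.
    ... | no ∅ = contradiction (subst Indep (sym (Empty-unique ∅)) ⊥-indep) (IsCycleSystem.dependent cs τ ne)
    ... | yes (e , e∈U) with uniqueUnion⁻ C₀ e∈U
    ...   | i , o@(i∈τ , _) = i , i∈τ ,
        subst (_< ∣ private-part C₀ τ i ∣) (sym (lookup-replicate i 0)) (x∈p⇒0<∣p∣ (∈private⁺ C₀ o))

    nonempty : E.list ≢ []
    nonempty eq with subst (replicate g 0 List.∈_) eq (E.complete zeroes-coparking (zeroOff⊤ {replicate g 0}))
    ... | ()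

    -- A maximal `a` equals its raised version, whose degree |`support C₀`| - g does not depend on
    -- `a`.
    degree : ∀ a → IsMaximal E.list a → sum a + ∣ ⊤ {g} ∣ ≡ ∣ support C₀ ∣
    degree a (a∈ , maximal) with raise-coparking ⊤ C₀ a (support-isUnion C₀) (proj₁ (E.sound a∈))
    ... | b , a≤b , cop , off , sum-b =
      subst (λ v → sum v + ∣ ⊤ {g} ∣ ≡ ∣ support C₀ ∣)
        (maximal (E.complete cop off) (lookup⇒≤ᵛ {a = a} {b} λ _ → a≤b ∈⊤)) sum-b

  private
    h : ℕ → ℤ
    h k = entry (hPoly M) (rank M ∸ k)

  entry-hVector : ∀ k → entry (hVector M) k ≡ ℤ.+ #ofDegree E.list k
  entry-hVector k with k ≤? rank M
  ... | yes k≤d = begin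
    entry (hVector M) k
      ≡⟨ entry-applyUpTo-< h (s≤s k≤d) ⟩
    entry (hPoly M) (rank M ∸ k)
      ≡⟨ entry-hPoly M (rank M ∸ k) ⟩
    ∑ (allSubsets n) (λ I → when (indep? I) (coeff (rank M ∸ ∣ I ∣) (rank M ∸ k)))
      ≡⟨ ∑-cong (allSubsets n) (λ I → when-⇔ (indep? I) (IndepBetween? M ⊥ ⊤ I)
           (λ ind → (⊥⊆ , ⊆⊤) , ind) proj₂) ⟩
    hSum M ⊥ ⊤ (rank M ∸ k)
      ≡⟨ E.hSum≡ (rank M ∸ k) ⟩
    ∑ E.list (λ a → when (∣ ⊥ {n} ∣ + sum a + (rank M ∸ k) ℕ.≟ rank M) 1ℤ)
      ≡⟨ ∑-cong E.list (λ a → when-⇔ (∣ ⊥ {n} ∣ + sum a + (rank M ∸ k) ℕ.≟ rank M) (sum a ℕ.≟ k)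
           (cancel a) (uncancel a)) ⟩
    ∑ E.list (λ a → when (sum a ℕ.≟ k) 1ℤ)
      ≡⟨ sym (length-filter (λ a → sum a ℕ.≟ k) E.list) ⟩
    ℤ.+ #ofDegree E.list k ∎
    where
    open ≡-Reasoning
    ∣⊥∣+ : ∀ a → ∣ ⊥ {n} ∣ + sum a + (rank M ∸ k) ≡ sum a + (rank M ∸ k)
    ∣⊥∣+ a = cong (λ m → m + sum a + (rank M ∸ k)) (∣⊥∣≡0 n)

    cancel : ∀ a → ∣ ⊥ {n} ∣ + sum a + (rank M ∸ k) ≡ rank M → sum a ≡ k
    cancel a eq = +-cancelʳ-≡ (rank M ∸ k) (sum a) k
      (trans (sym (∣⊥∣+ a)) (trans eq (sym (m+[n∸m]≡n k≤d))))

    uncancel : ∀ a → sum a ≡ k → ∣ ⊥ {n} ∣ + sum a + (rank M ∸ k) ≡ rank M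
    uncancel a eq = trans (∣⊥∣+ a) (trans (cong (_+ (rank M ∸ k)) eq) (m+[n∸m]≡n k≤d))
  -- Past the rank the list `hVector` reads as zero, and `bounded` leaves no coparking function of
  -- such a degree.
  ... | no k≰d = trans (entry-applyUpTo-≥ h (≰⇒> k≰d))
    (cong (ℤ.+_ ∘ length) (sym (filter-none _ (All.tabulate too-small))))
    where
    too-small : ∀ {a} → a List.∈ E.list → sum a ≢ k
    too-small {a} a∈ refl = k≰d (≤-trans (m≤n+m (sum a) ∣ ⊥ {n} ∣) (E.bounded a∈))

  hVector-isPureOSequence : IsPureOSequence (hVector M)
  hVector-isPureOSequence = g , E.list , coparkings-isPureOrderIdeal , entry-hVector

mainTheorem3 : ∀ {n g} (M : Matroid n) (𝒞 : Vec (Subset n) g) → IsCycleSystem M 𝒞 →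
    ((_≼_ : Rel (Fin n) 0ℓ) → IsTotalOrder _≡_ _≼_ →
    let open Procedures _≼_ in
    (∀ B → IsBasis M B → BasisToCoparking.WellDefined 𝒞 B × BasisToCoparking.Terminates 𝒞 B) ×
    (∀ a → IsCoparking 𝒞 a → CoparkingToBasis.WellDefined 𝒞 a × CoparkingToBasis.Terminates 𝒞 a) ×
    Σ (Inverse (Bases M) (P* 𝒞)) λ φ →
    (∀ B → BasisToCoparking.Outputs 𝒞 (proj₁ B) (proj₁ (Inverse.to φ B))) ×
    (∀ a → CoparkingToBasis.Outputs 𝒞 (proj₁ a) (proj₁ (Inverse.from φ a)))) ×
    IsPureOSequence (hVector M)
mainTheorem3 M 𝒞 cs =
  (λ _ tot →
    (λ B (indep , _) → (λ {s} → basisToCoparking-wellDefined tot M 𝒞 cs indep {s}) ,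
                       basisToCoparking-terminates tot 𝒞 B) ,
    (λ a cop → (λ {s} → coparkingToBasis-wellDefined tot 𝒞 a cop {s}) , coparkingToBasis-terminates tot 𝒞 a) ,
    bijection tot M 𝒞 cs , bijection-to-outputs tot M 𝒞 cs , bijection-from-outputs tot M 𝒞 cs) ,
  hVector-isPureOSequence M 𝒞 cs
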